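{- Let $n\ge 3$ and let $c_{ij}\ge 0$ ($1\le i,j\le n$) be travel costs. Fix $\varepsilon>0$. For $x=(x_{i,t})\in[0,1]^{n\times n}$, with the time index $t$ read cyclically modulo $n$, define $$Q(x):=\sum_{t=1}^n\sum_{i=1}^n\sum_{j=1}^n c_{ij}x_{i,t}x_{j,t+1},\qquad \rho_t(x):=\sum_{i=1}^n x_{i,t}-1,\qquad \kappa_i(x):=\sum_{t=1}^n x_{i,t}-1,$$ $$V_{\mathrm{time}}(x):=\sum_{t=1}^n\rho_t(x)^2+\sum_{i=1}^n\kappa_i(x)^2-2\sum_{i=1}^n\sum_{t=1}^n x_{i,t}^2+2\sum_{i=1}^n\sum_{t=1}^n x_{i,t},$$ $$\hat f_{\mathrm{time}}(x):=Q(x)+\varepsilon\sum_{i=1}^n\sum_{t=1}^n x_{i,t}+\gamma V_{\mathrm{time}}(x).$$ Then there exists a finite threshold $\gamma^\star_{\mathrm{time}}>0$ such that for all $\gamma>\gamma^\star_{\mathrm{time}}$, every local minimizer $x^\star$ of $\hat f_{\mathrm{time}}$ over $[0,1]^{n\times n}$ is binary, i.e. $x^\star\in\{0,1\}^{n\times n}$, and satisfies $$\sum_{i=1}^n x^\star_{i,t}=1\ \ \forall t,\qquad \sum_{t=1}^n x^\star_{i,t}=1\ \ \forall i.$$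
   Context: Time is cyclic: $x_{\cdot,n+1}:=x_{\cdot,1}$. A local minimizer over $[0,1]^{n\times n}$ is a point of the box minimizing $\hat f_{\mathrm{time}}$ among all points of the box in some neighborhood of it. -}

module Defs where

open import Algebra.Bundles.Raw using (RawMonoid)
open import Data.Fin.Base using (Fin; toℕ)
open import Data.Nat.Base as ℕ using (ℕ; suc)
open import Data.Nat.DivMod using (_mod_)
import Data.Nat.Properties as ℕₚ
open import Data.Product.Base using (∃; _×_; _,_; proj₁; proj₂)
open import Data.Rational.Base as ℚ using (ℚ; 0ℚ; 1ℚ; ½)
import Data.Rational.Properties as ℚₚ
open import Data.Rational.Solver using (module +-*-Solver)
open import Data.Sum.Base using (_⊎_; inj₁; inj₂)
open import Level using (0ℓ)
open import Relation.Binary.PropositionalEquality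

------------------------------------------------------------------------
-- Real numbers as Cauchy sequences of rationals, considered up to _≃_

IsCauchy : (ℕ → ℚ) → Set
IsCauchy a = ∀ ε → 0ℚ ℚ.< ε →
  ∃ λ N → ∀ m n → N ℕ.≤ m → N ℕ.≤ n → ℚ.∣ a m ℚ.- a n ∣ ℚ.≤ ε

record ℝ : Set where
  constructor mkℝ
  field
    seq    : ℕ → ℚ
    cauchy : IsCauchy seq

open ℝ public

infix  4 _<_ _≤_ _≃_
infixl 6 _+_ _-_
infixl 7 _*_
infix  8 -_ _²

_<_ : ℝ → ℝ → Set
x < y = ∃ λ ε → 0ℚ ℚ.< ε × ∃ λ N → ∀ n → N ℕ.≤ n → seq x n ℚ.+ ε ℚ.≤ seq y n

_≤_ : ℝ → ℝ → Set
x ≤ y = ∀ ε → 0ℚ ℚ.< ε → ∃ λ N → ∀ n → N ℕ.≤ n → seq x n ℚ.≤ seq y n ℚ.+ ε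

_≃_ : ℝ → ℝ → Set
x ≃ y = x ≤ y × y ≤ x

module CauchyProperties where

  open ℚₚ.≤-Reasoning

  abstract
    half-pos : ∀ {ε} → 0ℚ ℚ.< ε → 0ℚ ℚ.< ½ ℚ.* ε
    half-pos {ε} ε>0 =
      ℚₚ.positive⁻¹ _ {{ℚₚ.pos*pos⇒pos ½ ε {{ℚ.positive ε>0}}}}

    halves : ∀ ε → ½ ℚ.* ε ℚ.+ ½ ℚ.* ε ≡ ε
    halves ε = trans (sym (ℚₚ.*-distribʳ-+ ε ½ ½)) (ℚₚ.*-identityˡ ε)

    split : ∀ p q → ℚ.∣ p ∣ ℚ.≤ ℚ.∣ p ℚ.- q ∣ ℚ.+ ℚ.∣ q ∣
    split p q = begin
      ℚ.∣ p ∣                         ≡⟨ cong ℚ.∣_∣ (solve 2 (λ p q → p := (p :- q) :+ q) refl p q) ⟩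
      ℚ.∣ (p ℚ.- q) ℚ.+ q ∣           ≤⟨ ℚₚ.∣p+q∣≤∣p∣+∣q∣ (p ℚ.- q) q ⟩
      ℚ.∣ p ℚ.- q ∣ ℚ.+ ℚ.∣ q ∣       ∎
      where open +-*-Solver

    ∣-∣-sym : ∀ p q → ℚ.∣ p ℚ.- q ∣ ≡ ℚ.∣ q ℚ.- p ∣
    ∣-∣-sym p q = trans (cong ℚ.∣_∣ (solve 2 (λ p q → p :- q := :- (q :- p)) refl p q))
                        (ℚₚ.∣-p∣≡∣p∣ (q ℚ.- p))
      where open +-*-Solver

    ∣∣-nonexpansive : ∀ p q → ℚ.∣ ℚ.∣ p ∣ ℚ.- ℚ.∣ q ∣ ∣ ℚ.≤ ℚ.∣ p ℚ.- q ∣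
    ∣∣-nonexpansive p q with ℚₚ.∣p∣≡p∨∣p∣≡-p (ℚ.∣ p ∣ ℚ.- ℚ.∣ q ∣)
    ... | inj₁ e = subst (ℚ._≤ ℚ.∣ p ℚ.- q ∣) (sym e) (bound p q)
      where
      open +-*-Solver
      bound : ∀ p q → ℚ.∣ p ∣ ℚ.- ℚ.∣ q ∣ ℚ.≤ ℚ.∣ p ℚ.- q ∣
      bound p q = begin
        ℚ.∣ p ∣ ℚ.- ℚ.∣ q ∣                        ≤⟨ ℚₚ.+-monoˡ-≤ (ℚ.- ℚ.∣ q ∣) (split p q) ⟩
        ℚ.∣ p ℚ.- q ∣ ℚ.+ ℚ.∣ q ∣ ℚ.- ℚ.∣ q ∣      ≡⟨ solve 2 (λ a b → a :+ b :- b := a) refl ℚ.∣ p ℚ.- q ∣ ℚ.∣ q ∣ ⟩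
        ℚ.∣ p ℚ.- q ∣                              ∎
    ... | inj₂ e = begin
        ℚ.∣ ℚ.∣ p ∣ ℚ.- ℚ.∣ q ∣ ∣                  ≡⟨ e ⟩
        ℚ.- (ℚ.∣ p ∣ ℚ.- ℚ.∣ q ∣)                  ≡⟨ solve 2 (λ a b → :- (a :- b) := b :- a) refl ℚ.∣ p ∣ ℚ.∣ q ∣ ⟩
        ℚ.∣ q ∣ ℚ.- ℚ.∣ p ∣                        ≤⟨ ℚₚ.+-monoˡ-≤ (ℚ.- ℚ.∣ p ∣) (split q p) ⟩
        ℚ.∣ q ℚ.- p ∣ ℚ.+ ℚ.∣ p ∣ ℚ.- ℚ.∣ p ∣      ≡⟨ solve 2 (λ a b → a :+ b :- b := a) refl ℚ.∣ q ℚ.- p ∣ ℚ.∣ p ∣ ⟩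
        ℚ.∣ q ℚ.- p ∣                              ≡⟨ ∣-∣-sym q p ⟩
        ℚ.∣ p ℚ.- q ∣                              ∎
      where open +-*-Solver

    +-cauchy : ∀ a b → IsCauchy a → IsCauchy b → IsCauchy (λ n → a n ℚ.+ b n)
    +-cauchy a b ca cb ε ε>0
      with ca (½ ℚ.* ε) (half-pos ε>0) | cb (½ ℚ.* ε) (half-pos ε>0)
    ... | N , hN | M , hM = N ℕ.⊔ M , λ m n m≥ n≥ → begin
        ℚ.∣ (a m ℚ.+ b m) ℚ.- (a n ℚ.+ b n) ∣
          ≡⟨ cong ℚ.∣_∣ (solve 4 (λ a b c d → (a :+ b) :- (c :+ d) := (a :- c) :+ (b :- d)) refl (a m) (b m) (a n) (b n)) ⟩
        ℚ.∣ (a m ℚ.- a n) ℚ.+ (b m ℚ.- b n) ∣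
          ≤⟨ ℚₚ.∣p+q∣≤∣p∣+∣q∣ (a m ℚ.- a n) (b m ℚ.- b n) ⟩
        ℚ.∣ a m ℚ.- a n ∣ ℚ.+ ℚ.∣ b m ℚ.- b n ∣
          ≤⟨ ℚₚ.+-mono-≤ (hN m n (ℕₚ.m⊔n≤o⇒m≤o N M m≥) (ℕₚ.m⊔n≤o⇒m≤o N M n≥))
                         (hM m n (ℕₚ.m⊔n≤o⇒n≤o N M m≥) (ℕₚ.m⊔n≤o⇒n≤o N M n≥)) ⟩
        ½ ℚ.* ε ℚ.+ ½ ℚ.* ε
          ≡⟨ halves ε ⟩
        ε ∎
      where open +-*-Solver

    neg-cauchy : ∀ a → IsCauchy a → IsCauchy (λ n → ℚ.- a n)
    neg-cauchy a ca ε ε>0 with ca ε ε>0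
    ... | N , h = N , λ m n m≥ n≥ → begin
        ℚ.∣ ℚ.- a m ℚ.- ℚ.- a n ∣   ≡⟨ cong ℚ.∣_∣ (solve 2 (λ p q → :- p :- :- q := q :- p) refl (a m) (a n)) ⟩
        ℚ.∣ a n ℚ.- a m ∣           ≤⟨ h n m n≥ m≥ ⟩
        ε                           ∎
      where open +-*-Solver

    ∣∣-cauchy : ∀ a → IsCauchy a → IsCauchy (λ n → ℚ.∣ a n ∣)
    ∣∣-cauchy a ca ε ε>0 with ca ε ε>0
    ... | N , h = N , λ m n m≥ n≥ →
        ℚₚ.≤-trans (∣∣-nonexpansive (a m) (a n)) (h m n m≥ n≥)

    ∣∣-nonNeg : ∀ p → 0ℚ ℚ.≤ ℚ.∣ p ∣
    ∣∣-nonNeg p = ℚₚ.nonNegative⁻¹ _ {{ℚₚ.∣-∣-nonNeg p}}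

    eventually-bounded : ∀ a → IsCauchy a →
      ∃ λ B → 0ℚ ℚ.< B × ∃ λ N → ∀ n → N ℕ.≤ n → ℚ.∣ a n ∣ ℚ.≤ B
    eventually-bounded a ca with ca 1ℚ (ℚₚ.positive⁻¹ 1ℚ)
    ... | N , h = 1ℚ ℚ.+ ℚ.∣ a N ∣
                , ℚₚ.+-mono-<-≤ (ℚₚ.positive⁻¹ 1ℚ) (∣∣-nonNeg (a N))
                , N
                , λ n n≥ → ℚₚ.≤-trans (split (a n) (a N))
                             (ℚₚ.+-monoˡ-≤ ℚ.∣ a N ∣ (h n N n≥ ℕₚ.≤-refl))

    ∣*∣-bound : ∀ p q A B → 0ℚ ℚ.≤ A → ℚ.∣ p ∣ ℚ.≤ A → ℚ.∣ q ∣ ℚ.≤ B →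
      ℚ.∣ p ℚ.* q ∣ ℚ.≤ A ℚ.* B
    ∣*∣-bound p q A B A≥0 p≤A q≤B = begin
      ℚ.∣ p ℚ.* q ∣           ≡⟨ ℚₚ.∣p*q∣≡∣p∣*∣q∣ p q ⟩
      ℚ.∣ p ∣ ℚ.* ℚ.∣ q ∣     ≤⟨ ℚₚ.*-monoʳ-≤-nonNeg ℚ.∣ q ∣ {{ℚₚ.∣-∣-nonNeg q}} p≤A ⟩
      A ℚ.* ℚ.∣ q ∣           ≤⟨ ℚₚ.*-monoˡ-≤-nonNeg A {{ℚ.nonNegative A≥0}} q≤B ⟩
      A ℚ.* B                 ∎

    product-difference : ∀ p q r s →
      p ℚ.* q ℚ.- r ℚ.* s ≡ p ℚ.* (q ℚ.- s) ℚ.+ s ℚ.* (p ℚ.- r)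
    product-difference = solve 4 (λ p q r s →
      p :* q :- r :* s := p :* (q :- s) :+ s :* (p :- r)) refl
      where open +-*-Solver

    product-bound : ∀ p q r s A B η → 0ℚ ℚ.≤ A → 0ℚ ℚ.≤ B →
      ℚ.∣ p ∣ ℚ.≤ A → ℚ.∣ s ∣ ℚ.≤ B → ℚ.∣ q ℚ.- s ∣ ℚ.≤ η → ℚ.∣ p ℚ.- r ∣ ℚ.≤ η →
      ℚ.∣ p ℚ.* q ℚ.- r ℚ.* s ∣ ℚ.≤ (A ℚ.+ B) ℚ.* η
    product-bound p q r s A B η A≥0 B≥0 p≤A s≤B qs pr = begin
      ℚ.∣ p ℚ.* q ℚ.- r ℚ.* s ∣
        ≡⟨ cong ℚ.∣_∣ (product-difference p q r s) ⟩
      ℚ.∣ p ℚ.* (q ℚ.- s) ℚ.+ s ℚ.* (p ℚ.- r) ∣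
        ≤⟨ ℚₚ.∣p+q∣≤∣p∣+∣q∣ (p ℚ.* (q ℚ.- s)) (s ℚ.* (p ℚ.- r)) ⟩
      ℚ.∣ p ℚ.* (q ℚ.- s) ∣ ℚ.+ ℚ.∣ s ℚ.* (p ℚ.- r) ∣
        ≤⟨ ℚₚ.+-mono-≤ (∣*∣-bound p (q ℚ.- s) A η A≥0 p≤A qs)
                       (∣*∣-bound s (p ℚ.- r) B η B≥0 s≤B pr) ⟩
      A ℚ.* η ℚ.+ B ℚ.* η
        ≡⟨ ℚₚ.*-distribʳ-+ η A B ⟨
      (A ℚ.+ B) ℚ.* η ∎

    divide : ∀ ε B → 0ℚ ℚ.< ε → 0ℚ ℚ.< B → ∃ λ η → 0ℚ ℚ.< η × B ℚ.* η ≡ ε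
    divide ε B ε>0 B>0 = ℚ.1/ B ℚ.* ε , ℚₚ.positive⁻¹ _ {{η-pos}} , (begin-equality
      B ℚ.* (ℚ.1/ B ℚ.* ε)   ≡⟨ ℚₚ.*-assoc B (ℚ.1/ B) ε ⟨
      B ℚ.* ℚ.1/ B ℚ.* ε     ≡⟨ cong (ℚ._* ε) (ℚₚ.*-inverseʳ B) ⟩
      1ℚ ℚ.* ε               ≡⟨ ℚₚ.*-identityˡ ε ⟩
      ε                      ∎)
      where
      instance
        B-pos : ℚ.Positive B
        B-pos = ℚ.positive B>0
        B-nonZero : ℚ.NonZero B
        B-nonZero = ℚₚ.pos⇒nonZero B
      η-pos : ℚ.Positive (ℚ.1/ B ℚ.* ε)
      η-pos = ℚₚ.pos*pos⇒pos (ℚ.1/ B) {{ℚₚ.1/pos⇒pos B}} ε {{ℚ.positive ε>0}}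

    *-cauchy : ∀ a b → IsCauchy a → IsCauchy b → IsCauchy (λ n → a n ℚ.* b n)
    *-cauchy a b ca cb ε ε>0 =
      let A , A>0 , K , hA = eventually-bounded a ca
          B , B>0 , L , hB = eventually-bounded b cb
          η , η>0 , Sη≡ε   = divide ε (A ℚ.+ B) ε>0 (ℚₚ.+-mono-< A>0 B>0)
          M , hM           = ca η η>0
          P , hP           = cb η η>0
      in (K ℕ.⊔ L) ℕ.⊔ (M ℕ.⊔ P) , λ m n m≥ n≥ →
        let KL≤m = ℕₚ.m⊔n≤o⇒m≤o (K ℕ.⊔ L) (M ℕ.⊔ P) m≥
            KL≤n = ℕₚ.m⊔n≤o⇒m≤o (K ℕ.⊔ L) (M ℕ.⊔ P) n≥
            MP≤m = ℕₚ.m⊔n≤o⇒n≤o (K ℕ.⊔ L) (M ℕ.⊔ P) m≥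
            MP≤n = ℕₚ.m⊔n≤o⇒n≤o (K ℕ.⊔ L) (M ℕ.⊔ P) n≥
        in subst (ℚ.∣ a m ℚ.* b m ℚ.- a n ℚ.* b n ∣ ℚ.≤_) Sη≡ε
             (product-bound (a m) (b m) (a n) (b n) A B η (ℚₚ.<⇒≤ A>0) (ℚₚ.<⇒≤ B>0)
               (hA m (ℕₚ.m⊔n≤o⇒m≤o K L KL≤m))
               (hB n (ℕₚ.m⊔n≤o⇒n≤o K L KL≤n))
               (hP m n (ℕₚ.m⊔n≤o⇒n≤o M P MP≤m) (ℕₚ.m⊔n≤o⇒n≤o M P MP≤n))
               (hM m n (ℕₚ.m⊔n≤o⇒m≤o M P MP≤m) (ℕₚ.m⊔n≤o⇒m≤o M P MP≤n)))

open CauchyProperties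

fromℚ : ℚ → ℝ
fromℚ q = mkℝ (λ _ → q) λ ε ε>0 → 0 , λ _ _ _ _ →
  subst (λ d → ℚ.∣ d ∣ ℚ.≤ ε) (sym (ℚₚ.+-inverseʳ q)) (ℚₚ.<⇒≤ ε>0)

0ℝ 1ℝ : ℝ
0ℝ = fromℚ 0ℚ
1ℝ = fromℚ 1ℚ

_+_ : ℝ → ℝ → ℝ
x + y = mkℝ (λ n → seq x n ℚ.+ seq y n) (+-cauchy (seq x) (seq y) (cauchy x) (cauchy y))

-_ : ℝ → ℝ
- x = mkℝ (λ n → ℚ.- seq x n) (neg-cauchy (seq x) (cauchy x))

_-_ : ℝ → ℝ → ℝ
x - y = x + (- y)

_*_ : ℝ → ℝ → ℝ
x * y = mkℝ (λ n → seq x n ℚ.* seq y n) (*-cauchy (seq x) (seq y) (cauchy x) (cauchy y))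

∣_∣ : ℝ → ℝ
∣ x ∣ = mkℝ (λ n → ℚ.∣ seq x n ∣) (∣∣-cauchy (seq x) (cauchy x))

_² : ℝ → ℝ
x ² = x * x

2ℝ : ℝ
2ℝ = 1ℝ + 1ℝ

+-0-rawMonoid : RawMonoid 0ℓ 0ℓ
+-0-rawMonoid = record { Carrier = ℝ ; _≈_ = _≃_ ; _∙_ = _+_ ; ε = 0ℝ }

open import Algebra.Definitions.RawMonoid +-0-rawMonoid public using (sum)

infixl 7 ∑-syntax

∑-syntax : ∀ n → (Fin n → ℝ) → ℝ
∑-syntax n f = sum f

syntax ∑-syntax n (λ i → e) = ∑[ i < n ] e

------------------------------------------------------------------------
-- In an assignment x : Matrix n the first index is the city and the
-- second the time; indices run over 0, …, n - 1 instead of 1, …, n.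

Matrix : ℕ → Set
Matrix n = Fin n → Fin n → ℝ

next : ∀ {n} → Fin n → Fin n
next {suc n} t = suc (toℕ t) mod suc n

module _ {n : ℕ} where

  Q : (c x : Matrix n) → ℝ
  Q c x = ∑[ t < n ] (∑[ i < n ] (∑[ j < n ] (c i j * x i t * x j (next t))))

  ρ : Matrix n → Fin n → ℝ
  ρ x t = (∑[ i < n ] x i t) - 1ℝ

  κ : Matrix n → Fin n → ℝ
  κ x i = (∑[ t < n ] x i t) - 1ℝ

  Vtime : Matrix n → ℝ
  Vtime x = (∑[ t < n ] (ρ x t ²)) + (∑[ i < n ] (κ x i ²))
          - 2ℝ * (∑[ i < n ] (∑[ t < n ] (x i t ²)))
          + 2ℝ * (∑[ i < n ] (∑[ t < n ] (x i t)))

  f̂time : (c : Matrix n) (ε γ : ℝ) → Matrix n → ℝ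
  f̂time c ε γ x = Q c x + ε * (∑[ i < n ] (∑[ t < n ] (x i t))) + γ * Vtime x

  InBox : Matrix n → Set
  InBox x = ∀ i t → 0ℝ ≤ x i t × x i t ≤ 1ℝ

  -- Open balls of the maximum norm form a neighbourhood base.
  IsLocalMinimizer : (Matrix n → ℝ) → Matrix n → Set
  IsLocalMinimizer f x = InBox x × ∃ λ δ → 0ℝ < δ ×
    (∀ y → InBox y → (∀ i t → ∣ y i t - x i t ∣ < δ) → f x ≤ f y)

  IsBinary : Matrix n → Set
  IsBinary x = ∀ i t → x i t ≃ 0ℝ ⊎ x i t ≃ 1ℝ

module Submission where

-- For n ≥ 2 the objective is affine in each entry separately: the squares of
-- x i t in ρ t ², κ i ² and - 2 (x i t)² cancel.  The slope at a cell a is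
-- D + ε + γ · 2 (O - 1), where 0 ≤ D ≤ cap c comes from Q, and O is the sum of
-- the other entries in the row and the column of a.  Let x be a local
-- minimizer and γ > cap c + ε.
--   * x a > 0 forces slope ≤ 0, hence O < 1.
--   * x a < 1 forces slope ≥ 0, hence O > 0.
--   * If 0 < x a < 1, then O > 0 yields an entry x b > 0 in the same line, and
--     x b ≤ O < 1.  Raising x a and lowering x b by the same s changes the
--     objective by at most - 2 γ s² < 0.
-- So x is binary, no two ones share a line, and every cell has a one in its
-- row or column; by the pigeonhole principle x is a permutation matrix.
--
-- Constructively, each of these facts serves to refute a strict inequality,
-- and ¬ (y < x) gives x ≤ y; the one decision needed is x < 1 or 0 < x.

open import Defs
open import Data.Nat.Base as ℕ using (ℕ)
open import Data.Fin.Base using (Fin)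
open import Data.Product.Base using (∃; _×_)

open import Algebra.Bundles using (CommutativeRing)
open import Algebra.Solver.Ring.AlmostCommutativeRing
open import Algebra.Structures using (IsCommutativeRing)
open import Data.Fin.Base using (zero; suc; toℕ; punchOut)
open import Data.Fin.Properties using (_≟_; any?; injective⇒≤; punchOut-injective; toℕ-fromℕ<; toℕ<n)
open import Data.Maybe.Base using (Maybe; just; nothing)
open import Data.Nat.DivMod using (m<n⇒m%n≡m; n%n≡0)
import Data.Nat.Properties as ℕₚ
open import Data.Product.Base using (_,_; proj₁; proj₂)
open import Data.Rational.Base as ℚ using (ℚ; 0ℚ; 1ℚ; ½)
import Data.Rational.Properties as ℚₚ
open import Data.Rational.Solver using (module +-*-Solver)
open import Data.Sum.Base using (_⊎_; inj₁; inj₂; map; swap)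
open import Level using (0ℓ)
open import Relation.Binary.PropositionalEquality using (_≡_; _≢_; refl; sym; trans; cong; subst)
open import Relation.Binary.Structures using (IsEquivalence; IsPreorder)
open import Relation.Nullary using (¬_; Dec; yes; no; contradiction)

open CauchyProperties

-- The relations of Defs unfold to statements about sequences, from which the
-- related reals cannot be inferred; hence the record types.
infix 4 _≼_ _≺_ _≈_

record _≼_ (x y : ℝ) : Set where
  constructor from-≤
  field to-≤ : x ≤ y
open _≼_

record _≈_ (x y : ℝ) : Set where
  constructor antisym
  field
    ≈⇒≼ : x ≼ y
    ≈⇒≽ : y ≼ x
open _≈_

-- A rational gap on top of `≼` instead of a termwise inequality: transitivity then comes from that
-- of `≼`, with no indices to compare. `<⇒≺` and `≺⇒<` translate.
record _≺_ (x y : ℝ) : Set where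
  constructor gapped
  field
    gap     : ℚ
    gap>0   : 0ℚ ℚ.< gap
    gap-≼   : x + fromℚ gap ≼ y
open _≺_

-- Order and products of Cauchy sequences, estimated term by term

≈⇒≃ : ∀ {x y} → x ≈ y → x ≃ y
≈⇒≃ (antisym x≼y y≼x) = to-≤ x≼y , to-≤ y≼x

p≤p+ε : ∀ p {ε} → 0ℚ ℚ.< ε → p ℚ.≤ p ℚ.+ ε
p≤p+ε p {ε} ε>0 = subst (ℚ._≤ p ℚ.+ ε) (ℚₚ.+-identityʳ p) (ℚₚ.+-monoʳ-≤ p (ℚₚ.<⇒≤ ε>0))

+-halves : ∀ p ε → p ℚ.+ ½ ℚ.* ε ℚ.+ ½ ℚ.* ε ≡ p ℚ.+ ε
+-halves p ε = trans (ℚₚ.+-assoc p _ _) (cong (p ℚ.+_) (halves ε))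

abstract
  ≡⇒≼ : ∀ {x y} → (∀ n → seq x n ≡ seq y n) → x ≼ y
  ≡⇒≼ {x} {y} e = from-≤ λ ε ε>0 → 0 , λ n _ →
    subst (ℚ._≤ seq y n ℚ.+ ε) (sym (e n)) (p≤p+ε (seq y n) ε>0)

  pointwise : ∀ {x y} → (∀ n → seq x n ≡ seq y n) → x ≈ y
  pointwise e = antisym (≡⇒≼ e) (≡⇒≼ λ n → sym (e n))

  ≼-trans : ∀ {x y z} → x ≼ y → y ≼ z → x ≼ z
  ≼-trans {x} {y} {z} (from-≤ x≤y) (from-≤ y≤z) = from-≤ λ ε ε>0 →
    let N , h = x≤y (½ ℚ.* ε) (half-pos ε>0)
        M , k = y≤z (½ ℚ.* ε) (half-pos ε>0)
    in N ℕ.⊔ M , λ n n≥ → ℚₚ.≤-trans (h n (ℕₚ.m⊔n≤o⇒m≤o N M n≥))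
         (subst (seq y n ℚ.+ ½ ℚ.* ε ℚ.≤_) (+-halves (seq z n) ε)
           (ℚₚ.+-monoˡ-≤ (½ ℚ.* ε) (k n (ℕₚ.m⊔n≤o⇒n≤o N M n≥))))

  +-mono-≼ : ∀ {x y u v} → x ≼ y → u ≼ v → x + u ≼ y + v
  +-mono-≼ {x} {y} {u} {v} (from-≤ x≤y) (from-≤ u≤v) = from-≤ λ ε ε>0 →
    let N , h = x≤y (½ ℚ.* ε) (half-pos ε>0)
        M , k = u≤v (½ ℚ.* ε) (half-pos ε>0)
    in N ℕ.⊔ M , λ n n≥ →
      subst (seq x n ℚ.+ seq u n ℚ.≤_)
        (trans (solve 3 (λ p q e → (p :+ e) :+ (q :+ e) := (p :+ q) :+ e :+ e) refl
                 (seq y n) (seq v n) (½ ℚ.* ε))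
               (+-halves (seq y n ℚ.+ seq v n) ε))
        (ℚₚ.+-mono-≤ (h n (ℕₚ.m⊔n≤o⇒m≤o N M n≥)) (k n (ℕₚ.m⊔n≤o⇒n≤o N M n≥)))
    where open +-*-Solver

  fromℚ-mono : ∀ {p q} → p ℚ.≤ q → fromℚ p ≼ fromℚ q
  fromℚ-mono {p} {q} p≤q = from-≤ λ ε ε>0 → 0 , λ _ _ → ℚₚ.≤-trans p≤q (p≤p+ε q ε>0)

  -- If `q < p`, a slack of half their distance is too small to bridge it.
  fromℚ-cancel-≼ : ∀ {p q} → fromℚ p ≼ fromℚ q → p ℚ.≤ q
  fromℚ-cancel-≼ {p} {q} (from-≤ h) = ℚₚ.≮⇒≥ λ q<p →
    let ε     = p ℚ.- q
        ε>0   = subst (ℚ._< ε) (ℚₚ.+-inverseʳ q) (ℚₚ.+-monoˡ-< (ℚ.- q) q<p)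
        N , k = h (½ ℚ.* ε) (half-pos ε>0)
        ε≤½ε  = subst (ε ℚ.≤_)
                  (solve 2 (λ q e → q :+ e :- q := e) refl q (½ ℚ.* ε))
                  (ℚₚ.+-monoˡ-≤ (ℚ.- q) (k N ℕₚ.≤-refl))
        0<½ε  = half-pos ε>0
        ½ε<ε  = subst (½ ℚ.* ε ℚ.<_) (halves ε)
                  (subst (ℚ._< ½ ℚ.* ε ℚ.+ ½ ℚ.* ε) (ℚₚ.+-identityʳ (½ ℚ.* ε))
                    (ℚₚ.+-monoʳ-< (½ ℚ.* ε) 0<½ε))
    in ℚₚ.<-irrefl refl (ℚₚ.<-≤-trans ½ε<ε ε≤½ε)
    where open +-*-Solver

  <⇒≺ : ∀ {x y} → x < y → x ≺ y
  <⇒≺ {x} {y} (q , q>0 , N , h) = gapped q q>0 (from-≤ λ ε ε>0 → N , λ n n≥ →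
    ℚₚ.≤-trans (h n n≥) (p≤p+ε (seq y n) ε>0))

  ≺⇒< : ∀ {x y} → x ≺ y → x < y
  ≺⇒< {x} {y} (gapped q q>0 (from-≤ h)) =
    -- Half of the gap absorbs the slack of `≼`; the other half remains as a termwise gap.
    let N , k = h (½ ℚ.* q) (half-pos q>0)
    in ½ ℚ.* q , half-pos q>0 , N , λ n n≥ →
      subst (seq x n ℚ.+ ½ ℚ.* q ℚ.≤_)
        (solve 2 (λ y e → y :+ e :- e := y) refl (seq y n) (½ ℚ.* q))
        (subst (ℚ._≤ seq y n ℚ.+ ½ ℚ.* q ℚ.- ½ ℚ.* q)
          (trans (cong (ℚ._- ½ ℚ.* q) (sym (+-halves (seq x n) q)))
            (solve 2 (λ x e → x :+ e :+ e :- e := x :+ e) refl (seq x n) (½ ℚ.* q)))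
          (ℚₚ.+-monoˡ-≤ (ℚ.- (½ ℚ.* q)) (k n n≥)))
    where open +-*-Solver

  p≤∣p∣ : ∀ p → p ℚ.≤ ℚ.∣ p ∣
  p≤∣p∣ p with ℚₚ.≤-total 0ℚ p
  ... | inj₁ 0≤p = ℚₚ.≤-reflexive (sym (ℚₚ.0≤p⇒∣p∣≡p 0≤p))
  ... | inj₂ p≤0 = ℚₚ.≤-trans p≤0 (∣∣-nonNeg p)

  ∣p-q∣≤η⇒p≤q+η : ∀ p q {η} → ℚ.∣ p ℚ.- q ∣ ℚ.≤ η → p ℚ.≤ q ℚ.+ η
  ∣p-q∣≤η⇒p≤q+η p q {η} h =
    subst (ℚ._≤ q ℚ.+ η) (solve 2 (λ p q → q :+ (p :- q) := p) refl p q)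
      (ℚₚ.+-monoʳ-≤ q (ℚₚ.≤-trans (p≤∣p∣ (p ℚ.- q)) h))
    where open +-*-Solver

  p≤q+η⇒∣p-q∣≤η : ∀ p q {η} → p ℚ.≤ q ℚ.+ η → q ℚ.≤ p ℚ.+ η → ℚ.∣ p ℚ.- q ∣ ℚ.≤ η
  p≤q+η⇒∣p-q∣≤η p q {η} h k with ℚₚ.∣p∣≡p∨∣p∣≡-p (p ℚ.- q)
  ... | inj₁ e = subst (ℚ._≤ η) (sym e)
          (subst (p ℚ.- q ℚ.≤_) (solve 2 (λ q e → q :+ e :- q := e) refl q η)
            (ℚₚ.+-monoˡ-≤ (ℚ.- q) h))
    where open +-*-Solver
  ... | inj₂ e = subst (ℚ._≤ η) (sym (trans e (solve 2 (λ p q → :- (p :- q) := q :- p) refl p q)))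
          (subst (q ℚ.- p ℚ.≤_) (solve 2 (λ q e → q :+ e :- q := e) refl p η)
            (ℚₚ.+-monoˡ-≤ (ℚ.- p) k))
    where open +-*-Solver

  fromℚ-mono-≺ : ∀ {p q} → p ℚ.< q → fromℚ p ≺ fromℚ q
  fromℚ-mono-≺ {p} {q} p<q = gapped (q ℚ.- p)
    (subst (ℚ._< q ℚ.- p) (ℚₚ.+-inverseʳ p) (ℚₚ.+-monoˡ-< (ℚ.- p) p<q))
    (≡⇒≼ λ _ → solve 2 (λ p q → p :+ (q :- p) := q) refl p q)
    where open +-*-Solver

  archimedean : ∀ {x y} → (∀ ε → 0ℚ ℚ.< ε → x ≼ y + fromℚ ε) → x ≼ y
  archimedean {x} {y} h = from-≤ λ ε ε>0 →
    let N , k = to-≤ (h (½ ℚ.* ε) (half-pos ε>0)) (½ ℚ.* ε) (half-pos ε>0)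
    in N , λ n n≥ → subst (seq x n ℚ.≤_) (+-halves (seq y n) ε) (k n n≥)

  approximate : ∀ x ε → 0ℚ ℚ.< ε → ∃ λ q → fromℚ q ≼ x × x ≼ fromℚ (q ℚ.+ ε)
  approximate x ε ε>0 =
    -- One term `a` beyond the modulus for `η` suffices: `x` lies between `a - η` and `a + η`, an
    -- interval of length `ε`.
    let η     = ½ ℚ.* ε
        N , h = cauchy x η (half-pos ε>0)
        a     = seq x N
    in a ℚ.- η
     , from-≤ (λ ε′ ε′>0 → N , λ n n≥ → ℚₚ.≤-trans
         (subst (a ℚ.- η ℚ.≤_) (solve 2 (λ p e → p :+ e :- e := p) refl (seq x n) η)
           (ℚₚ.+-monoˡ-≤ (ℚ.- η) (∣p-q∣≤η⇒p≤q+η a (seq x n) (h N n ℕₚ.≤-refl n≥))))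
         (p≤p+ε (seq x n) ε′>0))
     , from-≤ (λ ε′ ε′>0 → N , λ n n≥ → ℚₚ.≤-trans
         (subst (seq x n ℚ.≤_)
           (trans (solve 2 (λ p e → p :+ e := p :- e :+ (e :+ e)) refl a η)
                  (cong (a ℚ.- η ℚ.+_) (halves ε)))
           (∣p-q∣≤η⇒p≤q+η (seq x n) a (h n N n≥ ℕₚ.≤-refl)))
         (p≤p+ε (a ℚ.- η ℚ.+ ε) ε′>0))
    where open +-*-Solver

  lower : ∀ {p q} → 0ℚ ℚ.< p → 0ℚ ℚ.< q → ∃ λ r → 0ℚ ℚ.< r × r ℚ.≤ p × r ℚ.≤ q
  lower {p} {q} p>0 q>0 with ℚₚ.≤-total p q
  ... | inj₁ p≤q = p , p>0 , ℚₚ.≤-refl , p≤q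
  ... | inj₂ q≤p = q , q>0 , q≤p , ℚₚ.≤-refl

  abs-≤-⊎ : ∀ p r s → p ℚ.+ r ℚ.≤ s → ℚ.- p ℚ.+ r ℚ.≤ s → ℚ.∣ p ∣ ℚ.+ r ℚ.≤ s
  abs-≤-⊎ p r s a b with ℚₚ.∣p∣≡p∨∣p∣≡-p p
  ... | inj₁ e = subst (λ z → z ℚ.+ r ℚ.≤ s) (sym e) a
  ... | inj₂ e = subst (λ z → z ℚ.+ r ℚ.≤ s) (sym e) b

  abs-< : ∀ {x y} → x < y → - x < y → ∣ x ∣ < y
  abs-< {x} {y} (p , p>0 , N , h) (q , q>0 , M , k) =
    let r , r>0 , r≤p , r≤q = lower p>0 q>0
    in r , r>0 , N ℕ.⊔ M , λ n n≥ →
      abs-≤-⊎ (seq x n) r (seq y n)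
        (ℚₚ.≤-trans (ℚₚ.+-monoʳ-≤ (seq x n) {r} {p} r≤p) (h n (ℕₚ.m⊔n≤o⇒m≤o N M n≥)))
        (ℚₚ.≤-trans (ℚₚ.+-monoʳ-≤ (ℚ.- seq x n) {r} {q} r≤q) (k n (ℕₚ.m⊔n≤o⇒n≤o N M n≥)))

  -- The estimate behind `*-cauchy`: with x u - y v written as x (u - v) + v (x - y), eventual
  -- bounds on `x` and `v` suffice.
  *-resp-≼ : ∀ {x y u v} → x ≈ y → u ≈ v → x * u ≼ y * v
  *-resp-≼ {x} {y} {u} {v} (antisym (from-≤ x≤y) (from-≤ y≤x)) (antisym (from-≤ u≤v) (from-≤ v≤u)) =
    from-≤ λ ε ε>0 →
    let A , A>0 , N₁ , h₁ = eventually-bounded (seq x) (cauchy x)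
        B , B>0 , N₂ , h₂ = eventually-bounded (seq v) (cauchy v)
        η , η>0 , ≡ε      = divide ε (A ℚ.+ B) ε>0 (ℚₚ.+-mono-< A>0 B>0)
        N₃ , h₃           = x≤y η η>0
        N₄ , h₄           = y≤x η η>0
        N₅ , h₅           = u≤v η η>0
        N₆ , h₆           = v≤u η η>0
    in N₁ ℕ.⊔ (N₂ ℕ.⊔ (N₃ ℕ.⊔ (N₄ ℕ.⊔ (N₅ ℕ.⊔ N₆)))) , λ n n≥₁ →
      let n≥₂ = ℕₚ.m⊔n≤o⇒n≤o N₁ _ n≥₁
          n≥₃ = ℕₚ.m⊔n≤o⇒n≤o N₂ _ n≥₂
          n≥₄ = ℕₚ.m⊔n≤o⇒n≤o N₃ _ n≥₃
          n≥₅ = ℕₚ.m⊔n≤o⇒n≤o N₄ _ n≥₄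
      in ∣p-q∣≤η⇒p≤q+η (seq x n ℚ.* seq u n) (seq y n ℚ.* seq v n)
         (subst (ℚ.∣ seq x n ℚ.* seq u n ℚ.- seq y n ℚ.* seq v n ∣ ℚ.≤_) ≡ε
           (product-bound (seq x n) (seq u n) (seq y n) (seq v n) A B η (ℚₚ.<⇒≤ A>0) (ℚₚ.<⇒≤ B>0)
             (h₁ n (ℕₚ.m⊔n≤o⇒m≤o N₁ _ n≥₁))
             (h₂ n (ℕₚ.m⊔n≤o⇒m≤o N₂ _ n≥₂))
             (p≤q+η⇒∣p-q∣≤η (seq u n) (seq v n) (h₅ n (ℕₚ.m⊔n≤o⇒m≤o N₅ N₆ n≥₅)) (h₆ n (ℕₚ.m⊔n≤o⇒n≤o N₅ N₆ n≥₅)))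
             (p≤q+η⇒∣p-q∣≤η (seq x n) (seq y n) (h₃ n (ℕₚ.m⊔n≤o⇒m≤o N₃ _ n≥₃)) (h₄ n (ℕₚ.m⊔n≤o⇒m≤o N₄ _ n≥₄)))))

  -- Gives a nonnegative real a representative with nonnegative terms only; this is how `0≼*`
  -- reduces to a termwise fact.
  ≽0⇒≈∣∣ : ∀ {x} → 0ℝ ≼ x → x ≈ ∣ x ∣
  ≽0⇒≈∣∣ {x} (from-≤ 0≤x) = antisym
    (from-≤ λ ε ε>0 → 0 , λ n _ → ℚₚ.≤-trans (p≤∣p∣ (seq x n)) (p≤p+ε ℚ.∣ seq x n ∣ ε>0))
    (from-≤ λ ε ε>0 →
      let N , h = 0≤x (½ ℚ.* ε) (half-pos ε>0)
      in N , λ n n≥ → ∣p∣≤p+ε ε ε>0 (h n n≥))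
    where
    ∣p∣≤p+ε : ∀ {p} ε → 0ℚ ℚ.< ε → 0ℚ ℚ.≤ p ℚ.+ ½ ℚ.* ε → ℚ.∣ p ∣ ℚ.≤ p ℚ.+ ε
    ∣p∣≤p+ε {p} ε ε>0 h with ℚₚ.∣p∣≡p∨∣p∣≡-p p
    ... | inj₁ e = subst (ℚ._≤ p ℚ.+ ε) (sym e) (p≤p+ε p ε>0)
    -- The absolute value is `- p` here, and adding 0 ≤ p + ε/2 twice to `- p` yields p + ε.
    ... | inj₂ e = subst (ℚ._≤ p ℚ.+ ε) (sym e)
      (subst (ℚ.- p ℚ.≤_) (trans (solve 2 (λ p e → :- p :+ (p :+ e :+ (p :+ e)) := p :+ e :+ e) refl p (½ ℚ.* ε)) (+-halves p ε))
        (subst (ℚ._≤ ℚ.- p ℚ.+ (p ℚ.+ ½ ℚ.* ε ℚ.+ (p ℚ.+ ½ ℚ.* ε))) (ℚₚ.+-identityʳ (ℚ.- p))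
          (ℚₚ.+-monoʳ-≤ (ℚ.- p) (ℚₚ.+-mono-≤ h h))))
      where open +-*-Solver

  ∣∣-*-nonNeg : ∀ x y → 0ℝ ≼ ∣ x ∣ * ∣ y ∣
  ∣∣-*-nonNeg x y = from-≤ λ ε ε>0 → 0 , λ n _ → ℚₚ.≤-trans
    (subst (0ℚ ℚ.≤_) (ℚₚ.∣p*q∣≡∣p∣*∣q∣ (seq x n) (seq y n)) (∣∣-nonNeg (seq x n ℚ.* seq y n)))
    (p≤p+ε (ℚ.∣ seq x n ∣ ℚ.* ℚ.∣ seq y n ∣) ε>0)

-- The commutative ring of reals and its solver

≼-refl : ∀ {x} → x ≼ x
≼-refl = ≡⇒≼ λ _ → refl

≈-refl : ∀ {x} → x ≈ x
≈-refl = antisym ≼-refl ≼-refl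

≈-sym : ∀ {x y} → x ≈ y → y ≈ x
≈-sym (antisym x≼y y≼x) = antisym y≼x x≼y

≈-trans : ∀ {x y z} → x ≈ y → y ≈ z → x ≈ z
≈-trans (antisym x≼y y≼x) (antisym y≼z z≼y) = antisym (≼-trans x≼y y≼z) (≼-trans z≼y y≼x)

≈-isEquivalence : IsEquivalence _≈_
≈-isEquivalence = record { refl = ≈-refl ; sym = ≈-sym ; trans = ≈-trans }

+-cong : ∀ {x y u v} → x ≈ y → u ≈ v → x + u ≈ y + v
+-cong (antisym x≼y y≼x) (antisym u≼v v≼u) = antisym (+-mono-≼ x≼y u≼v) (+-mono-≼ y≼x v≼u)

*-cong : ∀ {x y u v} → x ≈ y → u ≈ v → x * u ≈ y * v
*-cong x≈y u≈v = antisym (*-resp-≼ x≈y u≈v) (*-resp-≼ (≈-sym x≈y) (≈-sym u≈v))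

abstract
  -- Adding `- x - y` to both sides of `y ≈ x` turns them into `- x` and `- y`, so `+-cong`
  -- suffices.
  -‿cong : ∀ {x y} → x ≈ y → - x ≈ - y
  -‿cong {x} {y} x≈y = ≈-trans (pointwise λ n → solve 2 (λ p q → :- p := :- p :- q :+ q) refl (seq x n) (seq y n))
    (≈-trans (+-cong (≈-refl { - x - y }) (≈-sym x≈y))
      (pointwise λ n → solve 2 (λ p q → :- p :- q :+ p := :- q) refl (seq x n) (seq y n)))
    where open +-*-Solver

ℝ-isCommutativeRing : IsCommutativeRing _≈_ _+_ _*_ -_ 0ℝ 1ℝ
ℝ-isCommutativeRing = record
  { isRing = record
    { +-isAbelianGroup = record
      { isGroup = record
        { isMonoid = record
          { isSemigroup = record
            { isMagma = record { isEquivalence = ≈-isEquivalence ; ∙-cong = +-cong }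
            ; assoc   = λ x y z → pointwise λ n → ℚₚ.+-assoc (seq x n) (seq y n) (seq z n)
            }
          ; identity = (λ x → pointwise λ n → ℚₚ.+-identityˡ (seq x n))
                     , (λ x → pointwise λ n → ℚₚ.+-identityʳ (seq x n))
          }
        ; inverse = (λ x → pointwise λ n → ℚₚ.+-inverseˡ (seq x n))
                  , (λ x → pointwise λ n → ℚₚ.+-inverseʳ (seq x n))
        ; ⁻¹-cong = -‿cong
        }
      ; comm = λ x y → pointwise λ n → ℚₚ.+-comm (seq x n) (seq y n)
      }
    ; *-cong     = *-cong
    ; *-assoc    = λ x y z → pointwise λ n → ℚₚ.*-assoc (seq x n) (seq y n) (seq z n)
    ; *-identity = (λ x → pointwise λ n → ℚₚ.*-identityˡ (seq x n))
                 , (λ x → pointwise λ n → ℚₚ.*-identityʳ (seq x n))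
    ; distrib    = (λ x y z → pointwise λ n → ℚₚ.*-distribˡ-+ (seq x n) (seq y n) (seq z n))
                 , (λ x y z → pointwise λ n → ℚₚ.*-distribʳ-+ (seq x n) (seq y n) (seq z n))
    }
  ; *-comm = λ x y → pointwise λ n → ℚₚ.*-comm (seq x n) (seq y n)
  }

ℝ-commutativeRing : CommutativeRing 0ℓ 0ℓ
ℝ-commutativeRing = record { isCommutativeRing = ℝ-isCommutativeRing }

ℝ-almostCommutativeRing : AlmostCommutativeRing 0ℓ 0ℓ
ℝ-almostCommutativeRing = fromCommutativeRing ℝ-commutativeRing

-- Makes the rationals the coefficients of the ring solver: their equality is decidable, and
-- constants like ½ may occur in identities.
fromℚ-morphism : ℚ.+-*-rawRing -Raw-AlmostCommutative⟶ ℝ-almostCommutativeRing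
fromℚ-morphism = record
  { ⟦_⟧    = fromℚ
  ; +-homo = λ _ _ → pointwise λ _ → refl
  ; *-homo = λ _ _ → pointwise λ _ → refl
  ; -‿homo = λ _ → pointwise λ _ → refl
  ; 0-homo = ≈-refl
  ; 1-homo = ≈-refl
  }

fromℚ-≟ : (p q : ℚ) → Maybe (fromℚ p ≈ fromℚ q)
fromℚ-≟ p q with p ℚₚ.≟ q
... | yes refl = just ≈-refl
... | no _     = nothing

open import Algebra.Solver.Ring ℚ.+-*-rawRing ℝ-almostCommutativeRing fromℚ-morphism fromℚ-≟
  using (Polynomial; solve; _:=_; _:+_; _:-_; _:*_; :-_; con)

two : ∀ {k} → Polynomial k
two = con 1ℚ :+ con 1ℚ

¼ : ℚ
¼ = ½ ℚ.* ½

-- Comparison of reals and signs of products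

≼-isPreorder : IsPreorder _≈_ _≼_
≼-isPreorder = record { isEquivalence = ≈-isEquivalence ; reflexive = ≈⇒≼ ; trans = ≼-trans }

fromℚ-nonNeg : ∀ {q} → 0ℚ ℚ.< q → 0ℝ ≼ fromℚ q
fromℚ-nonNeg q>0 = fromℚ-mono (ℚₚ.<⇒≤ q>0)

≺⇒≼ : ∀ {x y} → x ≺ y → x ≼ y
≺⇒≼ {x} (gapped q q>0 h) = ≼-trans (≈⇒≼ (solve 1 (λ x → x := x :+ con 0ℚ) ≈-refl x))
  (≼-trans (+-mono-≼ (≼-refl {x}) (fromℚ-nonNeg q>0)) h)

≺-≼-trans : ∀ {x y z} → x ≺ y → y ≼ z → x ≺ z
≺-≼-trans (gapped q q>0 h) y≼z = gapped q q>0 (≼-trans h y≼z)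

≼-≺-trans : ∀ {x y z} → x ≼ y → y ≺ z → x ≺ z
≼-≺-trans x≼y (gapped q q>0 h) = gapped q q>0 (≼-trans (+-mono-≼ x≼y ≼-refl) h)

≺-trans : ∀ {x y z} → x ≺ y → y ≺ z → x ≺ z
≺-trans x≺y y≺z = ≺-≼-trans x≺y (≺⇒≼ y≺z)

-- The equation says that v - u equals q - p. An inequality thus reduces to a known one plus an
-- identity for the ring solver.
≼-by : ∀ {p q u v} → p ≼ q → u + q ≈ v + p → u ≼ v
≼-by {p} {q} {u} {v} p≼q e =
  ≼-trans (≈⇒≼ (solve 2 (λ u q → u := u :+ q :- q) ≈-refl u q))
  (≼-trans (+-mono-≼ (≈⇒≼ e) (≼-refl { - q }))
  (≼-trans (≈⇒≼ (solve 3 (λ v p q → v :+ p :- q := p :+ (v :- q)) ≈-refl v p q))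
  (≼-trans (+-mono-≼ p≼q (≼-refl {v - q}))
           (≈⇒≼ (solve 2 (λ v q → q :+ (v :- q) := v) ≈-refl v q)))))

≺⇒⋡ : ∀ {x y} → x ≺ y → ¬ (y ≼ x)
≺⇒⋡ {x} {y} (gapped q q>0 h) y≼x = ℚₚ.<⇒≢ q>0 (ℚₚ.≤-antisym (ℚₚ.<⇒≤ q>0)
  (fromℚ-cancel-≼ (≼-by (≼-trans h y≼x) (solve 2 (λ x q → q :+ x := con 0ℚ :+ (x :+ q)) ≈-refl x (fromℚ q)))))

≺-irrefl : ∀ {x} → ¬ (x ≺ x)
≺-irrefl x≺x = ≺⇒⋡ x≺x ≼-refl

module ≼-Reasoning where
  open import Relation.Binary.Reasoning.Base.Triple ≼-isPreorder
    (λ x≺y y≺x → ≺-irrefl (≺-trans x≺y y≺x)) ≺-trans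
    ((λ y≈z x≺y → ≺-≼-trans x≺y (≈⇒≼ y≈z)) , (λ x≈y x≺z → ≼-≺-trans (≈⇒≽ x≈y) x≺z))
    ≺⇒≼ ≺-≼-trans ≼-≺-trans public

≺-by : ∀ {p q u v} → p ≺ q → u + q ≈ v + p → u ≺ v
≺-by {p} {q} {u} {v} (gapped r r>0 h) e = gapped r r>0 (≼-by h (begin-equality
  u + fromℚ r + q   ≈⟨ solve 3 (λ u r q → u :+ r :+ q := u :+ q :+ r) ≈-refl u (fromℚ r) q ⟩
  u + q + fromℚ r   ≈⟨ +-cong e ≈-refl ⟩
  v + p + fromℚ r   ≈⟨ solve 3 (λ v p r → v :+ p :+ r := v :+ (p :+ r)) ≈-refl v p (fromℚ r) ⟩
  v + (p + fromℚ r) ∎))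
  where open ≼-Reasoning

-- Rational order is decidable. With both reals located up to ε/2, a lower bound of `x` exceeding an
-- upper bound of `y` would prove `y ≺ x`; hence x ≤ y + ε for every ε.
⊀⇒≽ : ∀ {x y} → ¬ (y ≺ x) → x ≼ y
⊀⇒≽ {x} {y} y⊀x = archimedean λ ε ε>0 →
  let η           = ½ ℚ.* ε
      p , p≼x , x≼p+η = approximate x η (half-pos ε>0)
      q , q≼y , y≼q+η = approximate y η (half-pos ε>0)
      p≤q+η = ℚₚ.≮⇒≥ λ q+η<p → y⊀x (≺-≼-trans (≼-≺-trans y≼q+η (fromℚ-mono-≺ q+η<p)) p≼x)
  in begin
    x                              ≤⟨ x≼p+η ⟩
    fromℚ (p ℚ.+ η)                ≤⟨ fromℚ-mono (ℚₚ.+-monoˡ-≤ η p≤q+η) ⟩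
    fromℚ (q ℚ.+ η ℚ.+ η)          ≡⟨ cong fromℚ (+-halves q ε) ⟩
    fromℚ (q ℚ.+ ε)                ≈⟨ fromℚ-+ q ε ⟩
    fromℚ q + fromℚ ε              ≤⟨ +-mono-≼ q≼y ≼-refl ⟩
    y + fromℚ ε                    ∎
  where
  open ≼-Reasoning
  fromℚ-+ : ∀ p q → fromℚ (p ℚ.+ q) ≈ fromℚ p + fromℚ q
  fromℚ-+ p q = pointwise λ _ → refl

0≼* : ∀ {x y} → 0ℝ ≼ x → 0ℝ ≼ y → 0ℝ ≼ x * y
0≼* {x} {y} 0≼x 0≼y = begin
  0ℝ             ≤⟨ ∣∣-*-nonNeg x y ⟩
  ∣ x ∣ * ∣ y ∣  ≈⟨ *-cong (≽0⇒≈∣∣ 0≼x) (≽0⇒≈∣∣ 0≼y) ⟨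
  x * y          ∎
  where
  open ≼-Reasoning

*-monoˡ-≼ : ∀ {x y z} → 0ℝ ≼ z → x ≼ y → z * x ≼ z * y
*-monoˡ-≼ {x} {y} {z} 0≼z x≼y = ≼-by
  (0≼* 0≼z (≼-by x≼y (solve 2 (λ x y → con 0ℚ :+ y := y :- x :+ x) ≈-refl x y)))
  (solve 3 (λ x y z → z :* x :+ z :* (y :- x) := z :* y :+ con 0ℚ) ≈-refl x y z)

*-monoʳ-≼ : ∀ {x y z} → 0ℝ ≼ z → x ≼ y → x * z ≼ y * z
*-monoʳ-≼ {x} {y} {z} 0≼z x≼y = begin
  x * z  ≈⟨ *-comm x z ⟩
  z * x  ≤⟨ *-monoˡ-≼ 0≼z x≼y ⟩
  z * y  ≈⟨ *-comm z y ⟩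
  y * z  ∎
  where
  open ≼-Reasoning
  open CommutativeRing ℝ-commutativeRing using (*-comm)

+-nonNeg : ∀ {x y} → 0ℝ ≼ x → 0ℝ ≼ y → 0ℝ ≼ x + y
+-nonNeg 0≼x 0≼y = ≼-trans (≈⇒≼ (solve 0 (con 0ℚ := con 0ℚ :+ con 0ℚ) ≈-refl)) (+-mono-≼ 0≼x 0≼y)

0≺* : ∀ {x y} → 0ℝ ≺ x → 0ℝ ≺ y → 0ℝ ≺ x * y
0≺* {x} {y} (gapped p p>0 p≼x) (gapped q q>0 q≼y) = gapped (p ℚ.* q) pq>0 (begin
  0ℝ + fromℚ (p ℚ.* q)              ≈⟨ pointwise (λ _ → ℚₚ.+-identityˡ (p ℚ.* q)) ⟩
  fromℚ (p ℚ.* q)                   ≈⟨ pointwise (λ _ → refl) ⟩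
  fromℚ p * fromℚ q                 ≈⟨ solve 2 (λ p q → p :* q := (con 0ℚ :+ p) :* (con 0ℚ :+ q)) ≈-refl (fromℚ p) (fromℚ q) ⟩
  (0ℝ + fromℚ p) * (0ℝ + fromℚ q)   ≤⟨ *-monoˡ-≼ (+-nonNeg ≼-refl (fromℚ-nonNeg p>0)) q≼y ⟩
  (0ℝ + fromℚ p) * y                ≤⟨ *-monoʳ-≼ (≼-trans (+-nonNeg ≼-refl (fromℚ-nonNeg q>0)) q≼y) p≼x ⟩
  x * y                             ∎)
  where
  open ≼-Reasoning
  pq>0 : 0ℚ ℚ.< p ℚ.* q
  pq>0 = ℚₚ.positive⁻¹ _ {{ℚₚ.pos*pos⇒pos p {{ℚ.positive p>0}} q {{ℚ.positive q>0}}}}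

-- A negative `y` would make `x * (- y)` positive. Step sizes are cancelled this way, without
-- reciprocals of reals.
*-cancelˡ-0≼ : ∀ {x y} → 0ℝ ≺ x → 0ℝ ≼ x * y → 0ℝ ≼ y
*-cancelˡ-0≼ {x} {y} 0≺x 0≼xy = ⊀⇒≽ λ y≺0 → ≺⇒⋡
  (0≺* 0≺x (≺-by y≺0 (solve 1 (λ y → con 0ℚ :+ con 0ℚ := :- y :+ y) ≈-refl y)))
  (≼-by 0≼xy (solve 2 (λ x y → x :* (:- y) :+ x :* y := con 0ℚ :+ con 0ℚ) ≈-refl x y))

-- Locating `x` up to ¼ and comparing with ½ gives x ≤ ¾ or x ≥ ½. The alternatives overlap, so a
-- rational approximation is enough to choose one.
≺1⊎0≺ : ∀ x → x ≺ 1ℝ ⊎ 0ℝ ≺ x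
≺1⊎0≺ x with approximate x ¼ (ℚₚ.positive⁻¹ ¼)
... | q , q≼x , x≼q+¼ with ℚₚ.≤-total q ½
...   | inj₁ q≤½ = inj₁ (gapped ¼ (ℚₚ.positive⁻¹ ¼) (begin
          x + fromℚ ¼                 ≤⟨ +-mono-≼ x≼q+¼ ≼-refl ⟩
          fromℚ (q ℚ.+ ¼) + fromℚ ¼   ≤⟨ +-mono-≼ (fromℚ-mono (ℚₚ.+-monoˡ-≤ ¼ q≤½)) ≼-refl ⟩
          fromℚ (½ ℚ.+ ¼) + fromℚ ¼   ≈⟨ pointwise (λ _ → refl) ⟩
          1ℝ                          ∎))
  where open ≼-Reasoning
...   | inj₂ ½≤q = inj₂ (gapped ½ (ℚₚ.positive⁻¹ ½) (begin
          0ℝ + fromℚ ½   ≈⟨ pointwise (λ _ → refl) ⟩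
          fromℚ ½        ≤⟨ fromℚ-mono ½≤q ⟩
          fromℚ q        ≤⟨ q≼x ⟩
          x              ∎))
  where open ≼-Reasoning

-- Finite sums

-- Carries an increment with factor `s` through a sum, one application per level of nesting. The
-- coefficient `g i` may itself depend on `s`, as it does for squares.
sum-affine : ∀ {n} {f g h : Fin n → ℝ} s → (∀ i → h i ≈ f i + s * g i) → sum h ≈ sum f + s * sum g
sum-affine {ℕ.zero} s e = solve 1 (λ s → con 0ℚ := con 0ℚ :+ s :* con 0ℚ) ≈-refl s
sum-affine {ℕ.suc n} {f} {g} {h} s e = begin-equality
  h zero + sum (λ i → h (suc i))
    ≈⟨ +-cong (e zero) (sum-affine s (λ i → e (suc i))) ⟩
  f zero + s * g zero + (sum (λ i → f (suc i)) + s * sum (λ i → g (suc i)))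
    ≈⟨ solve 5 (λ a b s c d → a :+ s :* b :+ (c :+ s :* d) := a :+ c :+ s :* (b :+ d)) ≈-refl
         (f zero) (g zero) s (sum (λ i → f (suc i))) (sum (λ i → g (suc i))) ⟩
  sum f + s * sum g ∎
  where open ≼-Reasoning

sum-line : ∀ {n} (f g : Fin n → ℝ) s → sum (λ i → f i + s * g i) ≈ sum f + s * sum g
sum-line f g s = sum-affine {f = f} {g} s (λ _ → ≈-refl)

sum-mono : ∀ {n} {f g : Fin n → ℝ} → (∀ i → f i ≼ g i) → sum f ≼ sum g
sum-mono {ℕ.zero}  h = ≼-refl
sum-mono {ℕ.suc n} h = +-mono-≼ (h zero) (sum-mono (λ i → h (suc i)))

sum-cong : ∀ {n} {f g : Fin n → ℝ} → (∀ i → f i ≈ g i) → sum f ≈ sum g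
sum-cong e = antisym (sum-mono (λ i → ≈⇒≼ (e i))) (sum-mono (λ i → ≈⇒≽ (e i)))

sum-zero : ∀ {n} {f : Fin n → ℝ} → (∀ i → f i ≈ 0ℝ) → sum f ≈ 0ℝ
sum-zero {ℕ.zero}  e = ≈-refl
sum-zero {ℕ.suc n} e = ≈-trans (+-cong (e zero) (sum-zero (λ i → e (suc i))))
                               (solve 0 (con 0ℚ :+ con 0ℚ := con 0ℚ) ≈-refl)

sum-nonNeg : ∀ {n} {f : Fin n → ℝ} → (∀ i → 0ℝ ≼ f i) → 0ℝ ≼ sum f
sum-nonNeg {ℕ.zero}  h = ≼-refl
sum-nonNeg {ℕ.suc n} h = +-nonNeg (h zero) (sum-nonNeg (λ i → h (suc i)))

-- The Kronecker delta, by recursion on both indices so that it reduces along with `sum`.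
δ : ∀ {n} → Fin n → Fin n → ℝ
δ zero    zero    = 1ℝ
δ zero    (suc _) = 0ℝ
δ (suc _) zero    = 0ℝ
δ (suc i) (suc j) = δ i j

δ-refl : ∀ {n} (i : Fin n) → δ i i ≈ 1ℝ
δ-refl zero    = ≈-refl
δ-refl (suc i) = δ-refl i

δ-≢ : ∀ {n} {i j : Fin n} → i ≢ j → δ i j ≈ 0ℝ
δ-≢ {i = zero}  {zero}  i≢j = contradiction refl i≢j
δ-≢ {i = zero}  {suc _} i≢j = ≈-refl
δ-≢ {i = suc _} {zero}  i≢j = ≈-refl
δ-≢ {i = suc _} {suc _} i≢j = δ-≢ (λ e → i≢j (cong suc e))

δ-idem : ∀ {n} (i j : Fin n) → δ i j * δ i j ≈ δ i j
δ-idem zero    zero    = solve 0 (con 1ℚ :* con 1ℚ := con 1ℚ) ≈-refl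
δ-idem zero    (suc _) = solve 0 (con 0ℚ :* con 0ℚ := con 0ℚ) ≈-refl
δ-idem (suc _) zero    = solve 0 (con 0ℚ :* con 0ℚ := con 0ℚ) ≈-refl
δ-idem (suc i) (suc j) = δ-idem i j

0≼1 : 0ℝ ≼ 1ℝ
0≼1 = fromℚ-nonNeg (ℚₚ.positive⁻¹ 1ℚ)

δ-nonNeg : ∀ {n} (i j : Fin n) → 0ℝ ≼ δ i j
δ-nonNeg zero    zero    = 0≼1
δ-nonNeg zero    (suc _) = ≼-refl
δ-nonNeg (suc _) zero    = ≼-refl
δ-nonNeg (suc i) (suc j) = δ-nonNeg i j

δ-≼1 : ∀ {n} (i j : Fin n) → δ i j ≼ 1ℝ
δ-≼1 zero    zero    = ≼-refl
δ-≼1 zero    (suc _) = 0≼1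
δ-≼1 (suc _) zero    = 0≼1
δ-≼1 (suc i) (suc j) = δ-≼1 i j

sum-δʳ : ∀ {n} (f : Fin n → ℝ) i → sum (λ j → f j * δ i j) ≈ f i
sum-δʳ f zero = begin-equality
  f zero * 1ℝ + sum (λ j → f (suc j) * 0ℝ)
    ≈⟨ +-cong ≈-refl (sum-zero (λ j → solve 1 (λ x → x :* con 0ℚ := con 0ℚ) ≈-refl (f (suc j)))) ⟩
  f zero * 1ℝ + 0ℝ
    ≈⟨ solve 1 (λ x → x :* con 1ℚ :+ con 0ℚ := x) ≈-refl (f zero) ⟩
  f zero ∎
  where open ≼-Reasoning
sum-δʳ f (suc i) = begin-equality
  f zero * 0ℝ + sum (λ j → f (suc j) * δ i j)  ≈⟨ +-cong ≈-refl (sum-δʳ (λ j → f (suc j)) i) ⟩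
  f zero * 0ℝ + f (suc i)                      ≈⟨ solve 2 (λ x y → x :* con 0ℚ :+ y := y) ≈-refl (f zero) (f (suc i)) ⟩
  f (suc i) ∎
  where open ≼-Reasoning

sum-δˡ : ∀ {n} (f : Fin n → ℝ) i → sum (λ j → δ i j * f j) ≈ f i
sum-δˡ f i = ≈-trans (sum-cong (λ j → solve 2 (λ x y → x :* y := y :* x) ≈-refl (δ i j) (f j))) (sum-δʳ f i)

-- Each term is at most `f j * δ i j`, and these products sum to `f i`.
sum-≼-term : ∀ {n} {f : Fin n → ℝ} i → (∀ j → i ≢ j → f j ≼ 0ℝ) → sum f ≼ f i
sum-≼-term {f = f} i h = ≼-trans (sum-mono bound) (≈⇒≼ (sum-δʳ f i))
  where
  open ≼-Reasoning
  bound : ∀ j → f j ≼ f j * δ i j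
  bound j with i ≟ j
  ... | yes refl = begin
    f j          ≈⟨ solve 1 (λ x → x := x :* con 1ℚ) ≈-refl (f j) ⟩
    f j * 1ℝ     ≈⟨ *-cong ≈-refl (δ-refl j) ⟨
    f j * δ i j  ∎
  ... | no i≢j = begin
    f j          ≤⟨ h j i≢j ⟩
    0ℝ           ≈⟨ solve 1 (λ x → con 0ℚ := x :* con 0ℚ) ≈-refl (f j) ⟩
    f j * 0ℝ     ≈⟨ *-cong ≈-refl (δ-≢ i≢j) ⟨
    f j * δ i j  ∎

term-≼-sum : ∀ {n} {f : Fin n → ℝ} → (∀ j → 0ℝ ≼ f j) → ∀ i → f i ≼ sum f
term-≼-sum {f = f} 0≼f i = ≼-trans (≈⇒≽ (sum-δʳ f i)) (sum-mono (λ j →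
  ≼-trans (*-monoˡ-≼ (0≼f j) (δ-≼1 i j)) (≈⇒≼ (solve 1 (λ x → x :* con 1ℚ := x) ≈-refl (f j)))))

-- As `i` and `j` differ, `δ i k + δ j k` is at most 1, so weighting the terms with it can only
-- lower the sum.
terms-≼-sum : ∀ {n} {f : Fin n → ℝ} → (∀ j → 0ℝ ≼ f j) → ∀ {i j} → i ≢ j → f i + f j ≼ sum f
terms-≼-sum {f = f} 0≼f {i} {j} i≢j = begin
  f i + f j                                            ≈⟨ +-cong (sum-δʳ f i) (sum-δʳ f j) ⟨
  sum (λ k → f k * δ i k) + sum (λ k → f k * δ j k)    ≈⟨ solve 2 (λ a b → a :+ b := a :+ con 1ℚ :* b) ≈-refl _ _ ⟩
  sum (λ k → f k * δ i k) + 1ℝ * sum (λ k → f k * δ j k)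
    ≈⟨ sum-affine 1ℝ (λ k → solve 3 (λ x a b → x :* (a :+ b) := x :* a :+ con 1ℚ :* (x :* b)) ≈-refl (f k) (δ i k) (δ j k)) ⟨
  sum (λ k → f k * (δ i k + δ j k))                    ≤⟨ sum-mono (λ k → *-monoˡ-≼ (0≼f k) (disjoint k)) ⟩
  sum (λ k → f k * 1ℝ)                                 ≈⟨ sum-cong (λ k → solve 1 (λ x → x :* con 1ℚ := x) ≈-refl (f k)) ⟩
  sum f                                                ∎
  where
  open ≼-Reasoning
  disjoint : ∀ k → δ i k + δ j k ≼ 1ℝ
  disjoint k with i ≟ k
  ... | yes refl = ≼-trans (+-mono-≼ (δ-≼1 i k) (≈⇒≼ (δ-≢ (λ j≡i → i≢j (sym j≡i)))))
                           (≈⇒≼ (solve 0 (con 1ℚ :+ con 0ℚ := con 1ℚ) ≈-refl))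
  ... | no i≢k   = ≼-trans (+-mono-≼ (≈⇒≼ (δ-≢ i≢k)) (δ-≼1 j k))
                           (≈⇒≼ (solve 0 (con 0ℚ :+ con 1ℚ := con 1ℚ) ≈-refl))

-- The effect of changing one entry

-- Without wrap-around the index grows by one; with it, the last index would have to be 0, contrary
-- to `2 ≤ n`.
next-≢ : ∀ {n} → 2 ℕ.≤ n → (t : Fin n) → t ≢ next t
next-≢ {ℕ.suc n} (ℕ.s≤s 1≤n) t t≡next with ℕₚ.m≤n⇒m<n∨m≡n (toℕ<n t)
... | inj₁ 1+t<1+n = ℕₚ.1+n≢n (sym (trans (cong toℕ t≡next) (trans (toℕ-fromℕ< _) (m<n⇒m%n≡m 1+t<1+n))))
... | inj₂ 1+t≡1+n = ℕₚ.m<n⇒n≢0 1≤n (trans (sym (ℕₚ.suc-injective 1+t≡1+n)) (trans (cong toℕ t≡next)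
        (trans (toℕ-fromℕ< _) (trans (cong (ℕ._% ℕ.suc n) 1+t≡1+n) (n%n≡0 (ℕ.suc n))))))

Cell : ℕ → Set
Cell n = Fin n × Fin n

module _ {n : ℕ} where

  unit : Cell n → Matrix n
  unit (i₀ , t₀) i t = δ i₀ i * δ t₀ t

  shift : Matrix n → Cell n → ℝ → Matrix n
  shift x a s i t = x i t + s * unit a i t

  -- The bilinear form with `Q` as its diagonal: `q c x x` is `Q c x` by definition, and linearity
  -- in each argument expands `Q`.
  q : (c x y : Matrix n) → ℝ
  q c x y = ∑[ t < n ] (∑[ i < n ] (∑[ j < n ] (c i j * x i t * y j (next t))))

  -- The derivative of `Q c` at `x` in the direction `unit a`.
  D : Matrix n → Cell n → Matrix n → ℝ
  D c a x = q c (unit a) x + q c x (unit a)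

  -- The entry at the cell occurs in both line sums, hence the factor 2.
  others : Cell n → Matrix n → ℝ
  others (i₀ , t₀) x = (∑[ i < n ] x i t₀) + (∑[ t < n ] x i₀ t) - 2ℝ * x i₀ t₀

  -- The partial derivative of `f̂time` in the entry at `a`; by `f̂time-shift` the first-order
  -- expansion is exact.
  slope : (c : Matrix n) (ε γ : ℝ) → Cell n → Matrix n → ℝ
  slope c ε γ a x = D c a x + ε + γ * (2ℝ * (others a x - 1ℝ))

  unit-nonNeg : ∀ a i t → 0ℝ ≼ unit a i t
  unit-nonNeg (i₀ , t₀) i t = 0≼* (δ-nonNeg i₀ i) (δ-nonNeg t₀ t)

  unit-≼1 : ∀ a i t → unit a i t ≼ 1ℝ
  unit-≼1 (i₀ , t₀) i t = begin
    δ i₀ i * δ t₀ t  ≤⟨ *-monoˡ-≼ (δ-nonNeg i₀ i) (δ-≼1 t₀ t) ⟩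
    δ i₀ i * 1ℝ      ≤⟨ *-monoʳ-≼ 0≼1 (δ-≼1 i₀ i) ⟩
    1ℝ * 1ℝ          ≈⟨ solve 0 (con 1ℚ :* con 1ℚ := con 1ℚ) ≈-refl ⟩
    1ℝ               ∎
    where open ≼-Reasoning

  unit-idem : ∀ a i t → unit a i t * unit a i t ≈ unit a i t
  unit-idem (i₀ , t₀) i t = ≈-trans
    (solve 2 (λ x y → x :* y :* (x :* y) := x :* x :* (y :* y)) ≈-refl (δ i₀ i) (δ t₀ t))
    (*-cong (δ-idem i₀ i) (δ-idem t₀ t))

  q-shiftˡ : ∀ c x a s y → q c (shift x a s) y ≈ q c x y + s * q c (unit a) y
  q-shiftˡ c x a s y = sum-affine s λ t → sum-affine s λ i → sum-affine s λ j →
    solve 5 (λ c x s u y → c :* (x :+ s :* u) :* y := c :* x :* y :+ s :* (c :* u :* y)) ≈-refl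
      (c i j) (x i t) s (unit a i t) (y j (next t))

  q-shiftʳ : ∀ c x a s y → q c y (shift x a s) ≈ q c y x + s * q c y (unit a)
  q-shiftʳ c x a s y = sum-affine s λ t → sum-affine s λ i → sum-affine s λ j →
    solve 5 (λ c x s u y → c :* y :* (x :+ s :* u) := c :* y :* x :+ s :* (c :* y :* u)) ≈-refl
      (c i j) (x j (next t)) s (unit a j (next t)) (y i t)

  q-nonNeg : ∀ {c x y} → (∀ i j → 0ℝ ≼ c i j) → (∀ i t → 0ℝ ≼ x i t) → (∀ i t → 0ℝ ≼ y i t) →
             0ℝ ≼ q c x y
  q-nonNeg 0≼c 0≼x 0≼y = sum-nonNeg λ t → sum-nonNeg λ i → sum-nonNeg λ j →
    0≼* (0≼* (0≼c i j) (0≼x i t)) (0≼y j (next t))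

  q-mono : ∀ {c x y x′ y′} → (∀ i j → 0ℝ ≼ c i j) → (∀ i t → 0ℝ ≼ x i t) → (∀ i t → 0ℝ ≼ y′ i t) →
           (∀ i t → x i t ≼ x′ i t) → (∀ i t → y i t ≼ y′ i t) → q c x y ≼ q c x′ y′
  q-mono 0≼c 0≼x 0≼y′ x≼x′ y≼y′ = sum-mono λ t → sum-mono λ i → sum-mono λ j → ≼-trans
    (*-monoˡ-≼ (0≼* (0≼c i j) (0≼x i t)) (y≼y′ j (next t)))
    (*-monoʳ-≼ (0≼y′ j (next t)) (*-monoˡ-≼ (0≼c i j) (x≼x′ i t)))

  -- Only entries at consecutive times are paired, and a time differs from its successor, so no
  -- entry meets itself.
  q-unit : 2 ℕ.≤ n → ∀ c a → q c (unit a) (unit a) ≈ 0ℝ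
  q-unit 2≤n c (i₀ , t₀) = sum-zero λ t → sum-zero λ i → sum-zero λ j → vanish t i j
    where
    vanish : ∀ t i j → c i j * (δ i₀ i * δ t₀ t) * (δ i₀ j * δ t₀ (next t)) ≈ 0ℝ
    vanish t i j with t₀ ≟ t
    ... | yes refl = ≈-trans (*-cong ≈-refl (*-cong ≈-refl (δ-≢ (next-≢ 2≤n t))))
      (solve 2 (λ x y → x :* (y :* con 0ℚ) := con 0ℚ) ≈-refl (c i j * (δ i₀ i * δ t₀ t)) (δ i₀ j))
    ... | no t₀≢t = ≈-trans (*-cong (*-cong ≈-refl (*-cong ≈-refl (δ-≢ t₀≢t))) ≈-refl)
      (solve 3 (λ x y z → x :* (y :* con 0ℚ) :* z := con 0ℚ) ≈-refl (c i j) (δ i₀ i) (δ i₀ j * δ t₀ (next t)))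

  Q-shift : 2 ℕ.≤ n → ∀ c x a s → Q c (shift x a s) ≈ Q c x + s * D c a x
  Q-shift 2≤n c x a s = begin-equality
    q c x′ x′
      ≈⟨ q-shiftˡ c x a s x′ ⟩
    q c x x′ + s * q c u x′
      ≈⟨ +-cong (q-shiftʳ c x a s x) (*-cong ≈-refl (q-shiftʳ c x a s u)) ⟩
    q c x x + s * q c x u + s * (q c u x + s * q c u u)
      ≈⟨ +-cong ≈-refl (*-cong ≈-refl (+-cong ≈-refl (*-cong ≈-refl (q-unit 2≤n c a)))) ⟩
    q c x x + s * q c x u + s * (q c u x + s * 0ℝ)
      ≈⟨ solve 4 (λ p s v w → p :+ s :* v :+ s :* (w :+ s :* con 0ℚ) := p :+ s :* (w :+ v)) ≈-refl
           (q c x x) s (q c x u) (q c u x) ⟩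
    q c x x + s * (q c u x + q c x u) ∎
    where
    open ≼-Reasoning
    x′ = shift x a s
    u  = unit a

  column-unit : ∀ i₀ t₀ t → sum (λ i → unit (i₀ , t₀) i t) ≈ δ t₀ t
  column-unit i₀ t₀ t = sum-δˡ (λ _ → δ t₀ t) i₀

  row-unit : ∀ i₀ t₀ i → sum (λ t → unit (i₀ , t₀) i t) ≈ δ i₀ i
  row-unit i₀ t₀ i = sum-δʳ (λ _ → δ i₀ i) t₀

  column-shift : ∀ x i₀ t₀ s t →
    sum (λ i → shift x (i₀ , t₀) s i t) ≈ sum (λ i → x i t) + s * δ t₀ t
  column-shift x i₀ t₀ s t = ≈-trans (sum-line (λ i → x i t) (λ i → unit (i₀ , t₀) i t) s)
    (+-cong ≈-refl (*-cong ≈-refl (column-unit i₀ t₀ t)))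

  row-shift : ∀ x i₀ t₀ s i →
    sum (λ t → shift x (i₀ , t₀) s i t) ≈ sum (λ t → x i t) + s * δ i₀ i
  row-shift x i₀ t₀ s i = ≈-trans (sum-line (x i) (unit (i₀ , t₀) i) s)
    (+-cong ≈-refl (*-cong ≈-refl (row-unit i₀ t₀ i)))

  entries-unit : ∀ (x : Matrix n) i₀ t₀ →
    sum (λ i → sum (λ t → x i t * unit (i₀ , t₀) i t)) ≈ x i₀ t₀
  entries-unit x i₀ t₀ = ≈-trans
    (sum-cong λ i → ≈-trans
      (sum-cong λ t → solve 3 (λ x d e → x :* (d :* e) := x :* d :* e) ≈-refl (x i t) (δ i₀ i) (δ t₀ t))
      (sum-δʳ (λ t → x i t * δ i₀ i) t₀))
    (sum-δʳ (λ i → x i t₀) i₀)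

  total-shift : ∀ x a s →
    sum (λ i → sum (λ t → shift x a s i t)) ≈ sum (λ i → sum (λ t → x i t)) + s * 1ℝ
  total-shift x a@(i₀ , t₀) s = ≈-trans (sum-affine s (λ i → sum-line (x i) (unit a i) s))
    (+-cong ≈-refl (*-cong ≈-refl (begin-equality
      sum (λ i → sum (λ t → unit a i t))        ≈⟨ sum-cong (row-unit i₀ t₀) ⟩
      sum (λ i → δ i₀ i)                        ≈⟨ sum-cong (λ i → solve 1 (λ x → x := con 1ℚ :* x) ≈-refl (δ i₀ i)) ⟩
      sum (λ i → 1ℝ * δ i₀ i)                   ≈⟨ sum-δʳ (λ _ → 1ℝ) i₀ ⟩
      1ℝ                                        ∎)))
    where open ≼-Reasoning

  -- For a 0-1 indicator `d` the square in the second-order term reduces to `d`; kept as a common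
  -- factor, `d` collapses a sum of such increments to one term.
  square-shift : ∀ {r d s r′} → r′ ≈ r + s * d → d * d ≈ d → r′ ² ≈ r ² + s * ((2ℝ * r + s) * d)
  square-shift {r} {d} {s} {r′} e idem = begin-equality
    r′ * r′                                      ≈⟨ *-cong e e ⟩
    (r + s * d) * (r + s * d)                    ≈⟨ solve 3 (λ r s d → (r :+ s :* d) :* (r :+ s :* d)
                                                      := r :* r :+ s :* (two :* r :* d :+ s :* (d :* d))) ≈-refl r s d ⟩
    r * r + s * (2ℝ * r * d + s * (d * d))       ≈⟨ +-cong ≈-refl (*-cong ≈-refl (+-cong ≈-refl (*-cong ≈-refl idem))) ⟩
    r * r + s * (2ℝ * r * d + s * d)             ≈⟨ solve 3 (λ r s d → r :* r :+ s :* (two :* r :* d :+ s :* d)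
                                                      := r :* r :+ s :* ((two :* r :+ s) :* d)) ≈-refl r s d ⟩
    r * r + s * ((2ℝ * r + s) * d)               ∎
    where
    open ≼-Reasoning

  -- The terms in s² are one from the column, one from the row and minus two from the squared
  -- entries, so they cancel. The last sum of `Vtime` adds 1 to the -2 of the two line defects,
  -- leaving -1.
  Vtime-shift : ∀ x a s → Vtime (shift x a s) ≈ Vtime x + s * (2ℝ * (others a x - 1ℝ))
  Vtime-shift x a@(i₀ , t₀) s = begin-equality
    Vtime (shift x a s)
      ≈⟨ +-cong (+-cong (+-cong ρ² κ²) (-‿cong (*-cong ≈-refl x²))) (*-cong ≈-refl (total-shift x a s)) ⟩
    A + s * (2ℝ * (C - 1ℝ) + s) + (B + s * (2ℝ * (R - 1ℝ) + s)) - 2ℝ * (P + s * (2ℝ * x i₀ t₀ + s)) + 2ℝ * (L + s * 1ℝ)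
      ≈⟨ solve 8 (λ A B P L C R x s →
           A :+ s :* (two :* (C :- con 1ℚ) :+ s)
             :+ (B :+ s :* (two :* (R :- con 1ℚ) :+ s)) :- two :* (P :+ s :* (two :* x :+ s))
             :+ two :* (L :+ s :* con 1ℚ)
           := A :+ B :- two :* P :+ two :* L :+ s :* (two :* (C :+ R :- two :* x :- con 1ℚ)))
           ≈-refl A B P L C R (x i₀ t₀) s ⟩
    A + B - 2ℝ * P + 2ℝ * L + s * (2ℝ * (C + R - 2ℝ * x i₀ t₀ - 1ℝ)) ∎
    where
    open ≼-Reasoning
    A = sum (λ t → ρ x t ²)
    B = sum (λ i → κ x i ²)
    P = sum (λ i → sum (λ t → x i t ²))
    L = sum (λ i → sum (λ t → x i t))
    C = sum (λ i → x i t₀)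
    R = sum (λ t → x i₀ t)
    minus1 : ∀ {r r′ s d} → r′ ≈ r + s * d → r′ - 1ℝ ≈ r - 1ℝ + s * d
    minus1 {r} {r′} {s} {d} e = ≈-trans (+-cong e ≈-refl)
      (solve 3 (λ r s d → r :+ s :* d :- con 1ℚ := r :- con 1ℚ :+ s :* d) ≈-refl r s d)
    ρ² : sum (λ t → ρ (shift x a s) t ²) ≈ A + s * (2ℝ * (C - 1ℝ) + s)
    ρ² = ≈-trans
      (sum-affine s (λ t → square-shift (minus1 (column-shift x i₀ t₀ s t)) (δ-idem t₀ t)))
      (+-cong ≈-refl (*-cong ≈-refl (sum-δʳ (λ t → 2ℝ * ρ x t + s) t₀)))
    κ² : sum (λ i → κ (shift x a s) i ²) ≈ B + s * (2ℝ * (R - 1ℝ) + s)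
    κ² = ≈-trans
      (sum-affine s (λ i → square-shift (minus1 (row-shift x i₀ t₀ s i)) (δ-idem i₀ i)))
      (+-cong ≈-refl (*-cong ≈-refl (sum-δʳ (λ i → 2ℝ * κ x i + s) i₀)))
    x² : sum (λ i → sum (λ t → shift x a s i t ²)) ≈ P + s * (2ℝ * x i₀ t₀ + s)
    x² = ≈-trans
      (sum-affine s (λ i → sum-affine s (λ t → square-shift ≈-refl (unit-idem a i t))))
      (+-cong ≈-refl (*-cong ≈-refl (entries-unit (λ i t → 2ℝ * x i t + s) i₀ t₀)))

  f̂time-shift : 2 ℕ.≤ n → ∀ c ε γ x a s →
    f̂time c ε γ (shift x a s) ≈ f̂time c ε γ x + s * slope c ε γ a x
  f̂time-shift 2≤n c ε γ x a s = ≈-trans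
    (+-cong (+-cong (Q-shift 2≤n c x a s) (*-cong ≈-refl (total-shift x a s)))
            (*-cong ≈-refl (Vtime-shift x a s)))
    (solve 8 (λ Q D ε L γ V W s →
       Q :+ s :* D :+ ε :* (L :+ s :* con 1ℚ) :+ γ :* (V :+ s :* W)
       := Q :+ ε :* L :+ γ :* V :+ s :* (D :+ ε :+ γ :* W)) ≈-refl
       (Q c x) (D c a x) ε (sum (λ i → sum (λ t → x i t))) γ (Vtime x) (2ℝ * (others a x - 1ℝ)) s)

  data _∥_ : Cell n → Cell n → Set where
    column : ∀ {i j t} → i ≢ j → (i , t) ∥ (j , t)
    row    : ∀ {i t u} → t ≢ u → (i , t) ∥ (i , u)

  -- `others b` is linear and takes the value 1 on `unit a`: the cell `a` lies on just one of the
  -- two lines through `b`, and the entry at `b` is untouched.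
  others-shift : ∀ x {a b} → a ∥ b → ∀ s → others b (shift x a s) ≈ others b x + s
  others-shift x {a} {b@(j , u)} a∥b s = ≈-trans
    (+-cong (+-cong (sum-line (λ i → x i u) (λ i → unit a i u) s) (sum-line (x j) (unit a j) s)) ≈-refl)
    (≈-trans
      (solve 7 (λ C R x s C′ R′ d → C :+ s :* C′ :+ (R :+ s :* R′) :- two :* (x :+ s :* d)
                 := C :+ R :- two :* x :+ s :* (C′ :+ R′ :- two :* d)) ≈-refl
        (sum (λ i → x i u)) (sum (λ t → x j t)) (x j u) s
        (sum (λ i → unit a i u)) (sum (λ t → unit a j t)) (unit a j u))
      (+-cong ≈-refl (≈-trans (*-cong ≈-refl (others-unit a∥b)) (solve 1 (λ s → s :* con 1ℚ := s) ≈-refl s))))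
    where
    others-unit : ∀ {a b} → a ∥ b → others b (unit a) ≈ 1ℝ
    others-unit (column {i} {j} {t} i≢j) = ≈-trans
      (+-cong (+-cong (≈-trans (column-unit i t t) (δ-refl t)) (≈-trans (row-unit i t j) (δ-≢ i≢j)))
              (-‿cong (*-cong ≈-refl (*-cong (δ-≢ i≢j) (δ-refl t)))))
      (solve 0 (con 1ℚ :+ con 0ℚ :- two :* (con 0ℚ :* con 1ℚ) := con 1ℚ) ≈-refl)
    others-unit (row {i} {t} {u} t≢u) = ≈-trans
      (+-cong (+-cong (≈-trans (column-unit i t u) (δ-≢ t≢u)) (≈-trans (row-unit i t i) (δ-refl i)))
              (-‿cong (*-cong ≈-refl (*-cong (δ-refl i) (δ-≢ t≢u)))))
      (solve 0 (con 0ℚ :+ con 1ℚ :- two :* (con 1ℚ :* con 0ℚ) := con 1ℚ) ≈-refl)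

  at : Matrix n → Cell n → ℝ
  at x (i , t) = x i t

  -- The common line carries both entries, the other line at least the entry at `a`; subtracting the
  -- latter twice leaves the entry at `b`.
  at-≼-others : ∀ {x} → (∀ i t → 0ℝ ≼ x i t) → ∀ {a b} → a ∥ b → at x b ≼ others a x
  at-≼-others {x} 0≼x (column {i} {j} {t} i≢j) = ≼-by
    (+-mono-≼ (terms-≼-sum (λ k → 0≼x k t) i≢j) (term-≼-sum (0≼x i) t))
    (solve 4 (λ a b C R → b :+ (C :+ R) := C :+ R :- two :* a :+ (a :+ b :+ a)) ≈-refl
      (x i t) (x j t) (sum (λ k → x k t)) (sum (x i)))
  at-≼-others {x} 0≼x (row {i} {t} {u} t≢u) = ≼-by
    (+-mono-≼ (term-≼-sum (λ k → 0≼x k t) i) (terms-≼-sum (0≼x i) t≢u))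
    (solve 4 (λ a b C R → b :+ (C :+ R) := C :+ R :- two :* a :+ (a :+ (a :+ b))) ≈-refl
      (x i t) (x i u) (sum (λ k → x k t)) (sum (x i)))

  -- Each of the two line sums is at most the entry at `a`, which `others` subtracts twice.
  others-≼0 : ∀ {x} a → (∀ {b} → a ∥ b → at x b ≼ 0ℝ) → others a x ≼ 0ℝ
  others-≼0 {x} (i , t) h = ≼-by
    (+-mono-≼ (sum-≼-term {f = λ k → x k t} i (λ j i≢j → h (column i≢j)))
              (sum-≼-term {f = x i} t (λ u t≢u → h (row t≢u))))
    (solve 3 (λ a C R → C :+ R :- two :* a :+ (a :+ a) := con 0ℚ :+ (C :+ R)) ≈-refl
      (x i t) (sum (λ k → x k t)) (sum (x i)))

-- Partial permutation matrices

-- Pigeonhole: removing a missed value with `punchOut` would give an injection into a smaller finite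
-- set.
injection-hits : ∀ {n} (f : Fin n → Fin n) → (∀ {s t} → f s ≡ f t → s ≡ t) → ∀ i → ¬ (∀ t → i ≢ f t)
injection-hits {ℕ.suc n} f inj i missed = ℕₚ.1+n≰n
  (injective⇒≤ {f = λ t → punchOut (missed t)} (λ {s} {t} e → inj (punchOut-injective (missed s) (missed t) e)))

-- If row `i` is empty, `covered` forces an element into every column. Choosing a row for each
-- column is injective, as a row holds at most one element, and never yields `i`, against
-- `injection-hits`.
row-nonempty : ∀ {n} (P : Fin n → Fin n → Set) → (∀ i t → Dec (P i t)) →
  (∀ {i t u} → P i t → P i u → t ≡ u) →
  (∀ i t → (∃ λ j → P j t) ⊎ (∃ λ u → P i u)) →
  ∀ i → ∃ λ t → P i t
row-nonempty P P? unique covered i with any? (P? i)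
... | yes found = found
... | no empty  = contradiction avoids (injection-hits pick injective i)
  where
  in-column : ∀ t → ∃ λ j → P j t
  in-column t with covered i t
  ... | inj₁ found = found
  ... | inj₂ found = contradiction found empty
  pick : _
  pick t = proj₁ (in-column t)
  injective : ∀ {s t} → pick s ≡ pick t → s ≡ t
  injective {s} {t} e = unique (proj₂ (in-column s)) (subst (λ j → P j t) (sym e) (proj₂ (in-column t)))
  avoids : ∀ t → i ≢ pick t
  avoids t i≡ = empty (t , subst (λ j → P j t) (sym i≡) (proj₂ (in-column t)))

-- Local minimizers

small : ∀ {x y} → 0ℝ ≺ x → 0ℝ ≺ y → ∃ λ s → 0ℝ ≺ s × s ≼ x × s ≼ y
small {x} {y} (gapped p p>0 p≼x) (gapped q q>0 q≼y) =
  let r , r>0 , r≤p , r≤q = lower p>0 q>0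
  in fromℚ r , fromℚ-mono-≺ r>0 , below r≤p p≼x , below r≤q q≼y
  where
  below : ∀ {r p x} → r ℚ.≤ p → 0ℝ + fromℚ p ≼ x → fromℚ r ≼ x
  below {r} {p} r≤p p≼x = ≼-trans (fromℚ-mono r≤p)
    (≼-trans (≈⇒≼ (solve 1 (λ p → p := con 0ℚ :+ p) ≈-refl (fromℚ p))) p≼x)

smaller : ∀ {x} → 0ℝ ≺ x → ∃ λ s → 0ℝ ≺ s × s ≺ x
smaller {x} 0≺x =
  let s , 0≺s , s≼x , _ = small 0≺x 0≺x
  in fromℚ ½ * s , 0≺* (fromℚ-mono-≺ (ℚₚ.positive⁻¹ ½)) 0≺s
   , ≺-≼-trans (≺-by (0≺* (fromℚ-mono-≺ (ℚₚ.positive⁻¹ ½)) 0≺s)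
       (solve 1 (λ s → con ½ :* s :+ con ½ :* s := s :+ con 0ℚ) ≈-refl s)) s≼x

0≺1 : 0ℝ ≺ 1ℝ
0≺1 = fromℚ-mono-≺ (ℚₚ.positive⁻¹ 1ℚ)

0≺2 : 0ℝ ≺ 2ℝ
0≺2 = ≺-trans 0≺1 (≺-by 0≺1 (solve 0 (con 1ℚ :+ con 1ℚ := con 1ℚ :+ con 1ℚ :+ con 0ℚ) ≈-refl))

0≺1- : ∀ {x} → x ≺ 1ℝ → 0ℝ ≺ 1ℝ - x
0≺1- {x} x≺1 = ≺-by x≺1 (solve 1 (λ x → con 0ℚ :+ con 1ℚ := con 1ℚ :- x :+ x) ≈-refl x)

-- The common shape of all perturbations used. The side conditions keep a raised or lowered entry in
-- the unit interval, so membership in the box and distance are checked once for every move.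
data Nudge (s p q : ℝ) : Set where
  stay : q ≈ p → Nudge s p q
  up   : q ≈ p + s → p + s ≼ 1ℝ → Nudge s p q
  down : q ≈ p - s → s ≼ p → Nudge s p q

nudge-≽0 : ∀ {s p q} → 0ℝ ≼ s → 0ℝ ≼ p → Nudge s p q → 0ℝ ≼ q
nudge-≽0 0≼s 0≼p (stay e)             = ≼-trans 0≼p (≈⇒≽ e)
nudge-≽0 0≼s 0≼p (up e _)             = ≼-trans (+-nonNeg 0≼p 0≼s) (≈⇒≽ e)
nudge-≽0 {s} {p} 0≼s 0≼p (down e s≼p) = ≼-trans
  (≼-by s≼p (solve 2 (λ s p → con 0ℚ :+ p := p :- s :+ s) ≈-refl s p)) (≈⇒≽ e)

nudge-≼1 : ∀ {s p q} → 0ℝ ≼ s → p ≼ 1ℝ → Nudge s p q → q ≼ 1ℝ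
nudge-≼1 0≼s p≼1 (stay e)           = ≼-trans (≈⇒≼ e) p≼1
nudge-≼1 0≼s p≼1 (up e p+s≼1)       = ≼-trans (≈⇒≼ e) p+s≼1
nudge-≼1 {s} {p} 0≼s p≼1 (down e _) = ≼-trans (≈⇒≼ e) (≼-trans
  (≼-by 0≼s (solve 2 (λ s p → p :- s :+ s := p :+ con 0ℚ) ≈-refl s p)) p≼1)

nudge-close : ∀ {s p q r} → 0ℝ ≼ s → s ≺ r → Nudge s p q → ∣ q - p ∣ < r
nudge-close {s} {p} {q} {r} 0≼s s≺r nudge = abs-< {q - p} {r}
  (≺⇒< (≼-≺-trans (proj₁ (bounds nudge)) s≺r)) (≺⇒< (≼-≺-trans (proj₂ (bounds nudge)) s≺r))
  where
  open ≼-Reasoning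
  -s≼s : - s ≼ s
  -s≼s = ≼-by (+-mono-≼ 0≼s 0≼s) (solve 1 (λ s → :- s :+ (s :+ s) := s :+ (con 0ℚ :+ con 0ℚ)) ≈-refl s)
  difference : ∀ {z} → q ≈ p + z → q - p ≈ z
  difference {z} e = ≈-trans (+-cong e ≈-refl) (solve 2 (λ p z → p :+ z :- p := z) ≈-refl p z)
  both : ∀ {z} → q ≈ p + z → z ≼ s → - z ≼ s → q - p ≼ s × - (q - p) ≼ s
  both e z≼s -z≼s = ≼-trans (≈⇒≼ (difference e)) z≼s , ≼-trans (≈⇒≼ (-‿cong (difference e))) -z≼s
  bounds : Nudge s p q → q - p ≼ s × - (q - p) ≼ s
  bounds (stay e)   = both {0ℝ} (≈-trans e (solve 1 (λ p → p := p :+ con 0ℚ) ≈-refl p)) 0≼s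
                        (≼-trans (≈⇒≼ (solve 0 (:- con 0ℚ := con 0ℚ) ≈-refl)) 0≼s)
  bounds (up e _)   = both e ≼-refl -s≼s
  bounds (down e _) = both e -s≼s (≈⇒≼ (solve 1 (λ s → :- (:- s) := s) ≈-refl s))

-- Entries of shifted matrices and bounds on the slope

module _ {n : ℕ} where

  ∥⇒≢ : ∀ {a b : Cell n} → a ∥ b → a ≢ b
  ∥⇒≢ (column i≢j) e = i≢j (cong proj₁ e)
  ∥⇒≢ (row t≢u)    e = t≢u (cong proj₂ e)

  shift-cases : ∀ (x : Matrix n) a s i t →
    (a ≡ (i , t) × shift x a s i t ≈ x i t + s) ⊎ (a ≢ (i , t) × shift x a s i t ≈ x i t)
  shift-cases x (i₀ , t₀) s i t with i₀ ≟ i | t₀ ≟ t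
  ... | yes refl | yes refl = inj₁ (refl , ≈-trans
    (+-cong ≈-refl (*-cong ≈-refl (*-cong (δ-refl i) (δ-refl t))))
    (solve 2 (λ x s → x :+ s :* (con 1ℚ :* con 1ℚ) := x :+ s) ≈-refl (x i t) s))
  ... | no i₀≢i | _ = inj₂ ((λ e → i₀≢i (cong proj₁ e)) , ≈-trans
    (+-cong ≈-refl (*-cong ≈-refl (*-cong (δ-≢ i₀≢i) ≈-refl)))
    (solve 3 (λ x s d → x :+ s :* (con 0ℚ :* d) := x) ≈-refl (x i t) s (δ t₀ t)))
  ... | yes refl | no t₀≢t = inj₂ ((λ e → t₀≢t (cong proj₂ e)) , ≈-trans
    (+-cong ≈-refl (*-cong ≈-refl (*-cong ≈-refl (δ-≢ t₀≢t))))
    (solve 3 (λ x s d → x :+ s :* (d :* con 0ℚ) := x) ≈-refl (x i t) s (δ i₀ i)))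

  Nonneg : Matrix n → Set
  Nonneg x = ∀ i t → 0ℝ ≼ x i t

  ones : Matrix n
  ones _ _ = 1ℝ

  -- Bounds `D c a x` for all cells and all `x` in the box at once: for nonnegative costs `q` is
  -- monotone, and `ones` dominates both `x` and `unit a`.
  cap : Matrix n → ℝ
  cap c = q c ones ones + q c ones ones

  cap-nonNeg : ∀ {c} → Nonneg c → 0ℝ ≼ cap c
  cap-nonNeg 0≼c = +-nonNeg (q-nonNeg 0≼c (λ _ _ → 0≼1) (λ _ _ → 0≼1)) (q-nonNeg 0≼c (λ _ _ → 0≼1) (λ _ _ → 0≼1))

  D-nonNeg : ∀ {c x} → Nonneg c → Nonneg x → ∀ a → 0ℝ ≼ D c a x
  D-nonNeg 0≼c 0≼x a = +-nonNeg (q-nonNeg 0≼c (unit-nonNeg a) 0≼x) (q-nonNeg 0≼c 0≼x (unit-nonNeg a))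

  D-≼-cap : ∀ {c x} → Nonneg c → Nonneg x → (∀ i t → x i t ≼ 1ℝ) → ∀ a → D c a x ≼ cap c
  D-≼-cap 0≼c 0≼x x≼1 a = +-mono-≼
    (q-mono 0≼c (unit-nonNeg a) (λ _ _ → 0≼1) (unit-≼1 a) x≼1)
    (q-mono 0≼c 0≼x (λ _ _ → 0≼1) x≼1 (unit-≼1 a))

  D-mono : ∀ {c x y} → Nonneg c → Nonneg x → (∀ i t → x i t ≼ y i t) → ∀ a → D c a x ≼ D c a y
  D-mono 0≼c 0≼x x≼y a = +-mono-≼
    (q-mono 0≼c (unit-nonNeg a) (λ i t → ≼-trans (0≼x i t) (x≼y i t)) (λ _ _ → ≼-refl) x≼y)
    (q-mono 0≼c 0≼x (unit-nonNeg a) x≼y (λ _ _ → ≼-refl))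

  -- `others b` grows by exactly `s`, while the cost part can only grow because costs are
  -- nonnegative. This interaction of two entries on a line drives `no-exchange`.
  slope-shift : ∀ {c ε γ x s} → Nonneg c → Nonneg x → 0ℝ ≼ s → ∀ {a b} → a ∥ b →
    slope c ε γ b x + γ * (2ℝ * s) ≼ slope c ε γ b (shift x a s)
  slope-shift {c} {ε} {γ} {x} {s} 0≼c 0≼x 0≼s {a} {b} a∥b = begin
    D c b x + ε + γ * (2ℝ * (others b x - 1ℝ)) + γ * (2ℝ * s)
      ≈⟨ solve 5 (λ D ε γ O s → D :+ ε :+ γ :* (two :* (O :- con 1ℚ)) :+ γ :* (two :* s)
           := D :+ ε :+ γ :* (two :* (O :+ s :- con 1ℚ))) ≈-refl (D c b x) ε γ (others b x) s ⟩
    D c b x + ε + γ * (2ℝ * (others b x + s - 1ℝ))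
      ≈⟨ +-cong ≈-refl (*-cong ≈-refl (*-cong ≈-refl (+-cong (others-shift x a∥b s) ≈-refl))) ⟨
    D c b x + ε + γ * (2ℝ * (others b (shift x a s) - 1ℝ))
      ≤⟨ +-mono-≼ (+-mono-≼ (D-mono 0≼c 0≼x raised b) ≼-refl) ≼-refl ⟩
    slope c ε γ b (shift x a s) ∎
    where
    open ≼-Reasoning
    raised : ∀ i t → x i t ≼ shift x a s i t
    raised i t = ≼-by (0≼* 0≼s (unit-nonNeg a i t))
      (solve 2 (λ x z → x :+ z := x :+ z :+ con 0ℚ) ≈-refl (x i t) (s * unit a i t))

-- First-order conditions and binary entries

module LocalMinimizer {n : ℕ} (2≤n : 2 ℕ.≤ n) (c : Matrix n) (0≼c : Nonneg c)
  (ε : ℝ) (0≺ε : 0ℝ ≺ ε) (γ : ℝ) (large : cap c + ε ≺ γ)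
  (x : Matrix n) (minimizer : IsLocalMinimizer (f̂time c ε γ) x) where

  open ≼-Reasoning

  G : Cell n → Matrix n → ℝ
  G = slope c ε γ

  0≼x : Nonneg x
  0≼x i t = from-≤ (proj₁ (proj₁ minimizer i t))

  x≼1 : ∀ i t → x i t ≼ 1ℝ
  x≼1 i t = from-≤ (proj₂ (proj₁ minimizer i t))

  0≺γ : 0ℝ ≺ γ
  0≺γ = ≼-≺-trans (+-nonNeg (cap-nonNeg 0≼c) (≺⇒≼ 0≺ε)) large

  -- The neighbourhood is open, so steps bounded by `≼` need a radius strictly inside it.
  ball : ∃ λ s → 0ℝ ≺ s × s ≺ proj₁ (proj₂ minimizer)
  ball = smaller (<⇒≺ {0ℝ} {proj₁ (proj₂ minimizer)} (proj₁ (proj₂ (proj₂ minimizer))))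

  radius : ℝ
  radius = proj₁ ball

  0≺radius : 0ℝ ≺ radius
  0≺radius = proj₁ (proj₂ ball)

  minimal : ∀ {s} → 0ℝ ≼ s → s ≼ radius → ∀ y → (∀ i t → Nudge s (x i t) (y i t)) →
            f̂time c ε γ x ≼ f̂time c ε γ y
  minimal 0≼s s≼radius y nudge = from-≤ (proj₂ (proj₂ (proj₂ minimizer)) y
    (λ i t → to-≤ (nudge-≽0 0≼s (0≼x i t) (nudge i t)) , to-≤ (nudge-≼1 0≼s (x≼1 i t) (nudge i t)))
    (λ i t → nudge-close 0≼s (≼-≺-trans s≼radius (proj₂ (proj₂ ball))) (nudge i t)))

  gain-nonNeg : ∀ {y g} → f̂time c ε γ x ≼ f̂time c ε γ y →
    f̂time c ε γ y ≈ f̂time c ε γ x + g → 0ℝ ≼ g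
  gain-nonNeg {y} {g} fx≼fy e = ≼-by (≼-trans fx≼fy (≈⇒≼ e))
    (solve 2 (λ f g → con 0ℚ :+ (f :+ g) := g :+ f) ≈-refl (f̂time c ε γ x) g)

  -- Lowering the entry by a small `s` stays in the box and changes the objective by -s times the
  -- slope, which minimality makes nonnegative.
  slope-≼0 : ∀ a → 0ℝ ≺ at x a → G a x ≼ 0ℝ
  slope-≼0 a 0≺xₐ =
    let s , 0≺s , s≼xₐ , s≼radius = small 0≺xₐ 0≺radius
        nudge = λ i t → lowered s≼xₐ (shift-cases x a (- s) i t)
        gain  = gain-nonNeg (minimal (≺⇒≼ 0≺s) s≼radius (shift x a (- s)) nudge)
                  (f̂time-shift 2≤n c ε γ x a (- s))
        -G    = *-cancelˡ-0≼ 0≺s (≼-trans gain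
                  (≈⇒≼ (solve 2 (λ s g → (:- s) :* g := s :* (:- g)) ≈-refl s (G a x))))
    in ≼-by -G (solve 1 (λ g → g :+ :- g := con 0ℚ :+ con 0ℚ) ≈-refl (G a x))
    where
    lowered : ∀ {s i t y} → s ≼ at x a →
      (a ≡ (i , t) × y ≈ x i t - s) ⊎ (a ≢ (i , t) × y ≈ x i t) → Nudge s (x i t) y
    lowered s≼xₐ (inj₁ (refl , e)) = down e s≼xₐ
    lowered s≼xₐ (inj₂ (_ , e))    = stay e

  ≼1-⇒+≼1 : ∀ {s p} → s ≼ 1ℝ - p → p + s ≼ 1ℝ
  ≼1-⇒+≼1 {s} {p} h = ≼-by h (solve 2 (λ s p → p :+ s :+ (con 1ℚ :- p) := con 1ℚ :+ s) ≈-refl s p)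

  -- The mirror image: room below 1 permits raising the entry.
  slope-≽0 : ∀ a → at x a ≺ 1ℝ → 0ℝ ≼ G a x
  slope-≽0 a xₐ≺1 =
    let s , 0≺s , s≼1-xₐ , s≼radius = small (0≺1- xₐ≺1) 0≺radius
        nudge = λ i t → raised s≼1-xₐ (shift-cases x a s i t)
    in *-cancelˡ-0≼ 0≺s (gain-nonNeg (minimal (≺⇒≼ 0≺s) s≼radius (shift x a s) nudge)
         (f̂time-shift 2≤n c ε γ x a s))
    where
    raised : ∀ {s i t y} → s ≼ 1ℝ - at x a →
      (a ≡ (i , t) × y ≈ x i t + s) ⊎ (a ≢ (i , t) × y ≈ x i t) → Nudge s (x i t) y
    raised s≼1-xₐ (inj₁ (refl , e)) = up e (≼1-⇒+≼1 s≼1-xₐ)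
    raised s≼1-xₐ (inj₂ (_ , e))    = stay e

  -- Otherwise cost part and penalty part of the slope are nonnegative, so the slope is at least
  -- `ε`, against `slope-≼0`.
  others-⋡1 : ∀ a → 0ℝ ≺ at x a → ¬ (1ℝ ≼ others a x)
  others-⋡1 a 0≺xₐ 1≼O = ≺⇒⋡ 0≺ε (≼-trans ε≼G (slope-≼0 a 0≺xₐ))
    where
    0≼O-1 : 0ℝ ≼ others a x - 1ℝ
    0≼O-1 = ≼-by 1≼O (solve 1 (λ O → con 0ℚ :+ O := O :- con 1ℚ :+ con 1ℚ) ≈-refl (others a x))
    ε≼G : ε ≼ G a x
    ε≼G = ≼-by (+-nonNeg (D-nonNeg 0≼c 0≼x a) (0≼* (≺⇒≼ 0≺γ) (0≼* (≺⇒≼ 0≺2) 0≼O-1)))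
      (solve 3 (λ ε D w → ε :+ (D :+ w) := D :+ ε :+ w :+ con 0ℚ) ≈-refl
        ε (D c a x) (γ * (2ℝ * (others a x - 1ℝ))))

  -- Otherwise the slope is at most cap c + ε - 2γ, which is negative above the threshold.
  others-⋠0 : ∀ a → at x a ≺ 1ℝ → ¬ (others a x ≼ 0ℝ)
  others-⋠0 a xₐ≺1 O≼0 = ≺⇒⋡ large (begin
    γ
      -- A nonnegative slope bounds even 2γ by the next line; γ ≥ 0 weakens this to `γ`, the form
      -- that `large` refutes.
      ≤⟨ ≼-by (+-mono-≼ (slope-≽0 a xₐ≺1) (≺⇒≼ 0≺γ))
           (solve 4 (λ D ε γ O → γ :+ (D :+ ε :+ γ :* (two :* (O :- con 1ℚ)) :+ γ)
             := D :+ ε :+ γ :* (two :* O) :+ (con 0ℚ :+ con 0ℚ)) ≈-refl (D c a x) ε γ (others a x)) ⟩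
    D c a x + ε + γ * (2ℝ * others a x)
      ≤⟨ +-mono-≼ (+-mono-≼ (D-≼-cap 0≼c 0≼x x≼1 a) ≼-refl) (*-monoˡ-≼ (≺⇒≼ 0≺γ) (*-monoˡ-≼ (≺⇒≼ 0≺2) O≼0)) ⟩
    cap c + ε + γ * (2ℝ * 0ℝ)
      ≈⟨ solve 2 (λ z γ → z :+ γ :* (two :* con 0ℚ) := z) ≈-refl (cap c + ε) γ ⟩
    cap c + ε ∎)

  -- Raising `a` by `s` lifts the slope at `b` to at least 2γs, while the slope at `a` is at most 0.
  -- Lowering `b` by the same `s` makes the total change at most -2γs², against minimality.
  no-exchange : ∀ {a b} → a ∥ b → 0ℝ ≺ at x a → at x a ≺ 1ℝ → 0ℝ ≺ at x b → ¬ (at x b ≺ 1ℝ)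
  no-exchange {a} {b} a∥b 0≺xₐ xₐ≺1 0≺x_b x_b≺1 =
    -- Three bounds on the step: room above at `a`, room below at `b`, and the radius.
    let s′ , 0≺s′ , s′≼1-xₐ , s′≼x_b = small (0≺1- xₐ≺1) 0≺x_b
        s , 0≺s , s≼s′ , s≼radius = small 0≺s′ 0≺radius
        x₁    = shift x a s
        nudge = λ i t → exchanged (≼-trans s≼s′ s′≼1-xₐ) (≼-trans s≼s′ s′≼x_b)
                  (shift-cases x a s i t) (shift-cases x₁ b (- s) i t)
        gain  = gain-nonNeg (minimal (≺⇒≼ 0≺s) s≼radius (shift x₁ b (- s)) nudge)
                  (≈-trans (f̂time-shift 2≤n c ε γ x₁ b (- s))
                  (≈-trans (+-cong (f̂time-shift 2≤n c ε γ x a s) ≈-refl)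
                    (solve 4 (λ f s g h → f :+ s :* g :+ (:- s) :* h := f :+ s :* (g :- h)) ≈-refl
                      (f̂time c ε γ x) s (G a x) (G b x₁))))
        Gₐ-G_b = *-cancelˡ-0≼ 0≺s gain
    in ≺⇒⋡ (0≺* 0≺γ (0≺* 0≺2 0≺s)) (begin
      γ * (2ℝ * s)              ≤⟨ ≼-by (slope-≽0 b x_b≺1)
                                     (solve 2 (λ w g → w :+ g := g :+ w :+ con 0ℚ) ≈-refl (γ * (2ℝ * s)) (G b x)) ⟩
      G b x + γ * (2ℝ * s)      ≤⟨ slope-shift 0≼c 0≼x (≺⇒≼ 0≺s) a∥b ⟩
      G b x₁                    ≤⟨ ≼-by Gₐ-G_b
                                     (solve 2 (λ g h → h :+ (g :- h) := g :+ con 0ℚ) ≈-refl (G a x) (G b x₁)) ⟩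
      G a x                     ≤⟨ slope-≼0 a 0≺xₐ ⟩
      0ℝ                        ∎)
    where
    exchanged : ∀ {s i t x₁ x₂} → s ≼ 1ℝ - at x a → s ≼ at x b →
      (a ≡ (i , t) × x₁ ≈ x i t + s) ⊎ (a ≢ (i , t) × x₁ ≈ x i t) →
      (b ≡ (i , t) × x₂ ≈ x₁ - s) ⊎ (b ≢ (i , t) × x₂ ≈ x₁) → Nudge s (x i t) x₂
    exchanged s≼1-xₐ s≼x_b (inj₁ (a≡ , _))   (inj₁ (b≡ , _))   = contradiction (trans a≡ (sym b≡)) (∥⇒≢ a∥b)
    exchanged s≼1-xₐ s≼x_b (inj₁ (refl , e)) (inj₂ (_ , e′))   = up (≈-trans e′ e) (≼1-⇒+≼1 s≼1-xₐ)
    exchanged s≼1-xₐ s≼x_b (inj₂ (_ , e))    (inj₁ (refl , e′)) = down (≈-trans e′ (+-cong e ≈-refl)) s≼x_b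
    exchanged s≼1-xₐ s≼x_b (inj₂ (_ , e))    (inj₂ (_ , e′))   = stay (≈-trans e′ e)

  at-⋡1 : ∀ {a b} → a ∥ b → 0ℝ ≺ at x a → ¬ (1ℝ ≼ at x b)
  at-⋡1 {a} a∥b 0≺xₐ 1≼x_b = others-⋡1 a 0≺xₐ (≼-trans 1≼x_b (at-≼-others 0≼x a∥b))

  -- No positive entry is extracted from `others`. Instead every other entry on the lines of `a` is
  -- shown nonpositive: a positive one is not below 1 by `no-exchange` and not at least 1 by
  -- `at-⋡1`.
  no-fraction : ∀ a → 0ℝ ≺ at x a → ¬ (at x a ≺ 1ℝ)
  no-fraction a 0≺xₐ xₐ≺1 = others-⋠0 a xₐ≺1 (others-≼0 a λ a∥b → ⊀⇒≽ λ 0≺x_b →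
    at-⋡1 a∥b 0≺xₐ (⊀⇒≽ (no-exchange a∥b 0≺xₐ xₐ≺1 0≺x_b)))

  binary : ∀ i t → x i t ≈ 0ℝ ⊎ x i t ≈ 1ℝ
  -- Either alternative supplies one strict bound; `no-fraction` refutes the other and pins the
  -- entry to an endpoint.
  binary i t with ≺1⊎0≺ (x i t)
  ... | inj₁ x≺1 = inj₁ (antisym (⊀⇒≽ (λ 0≺x → no-fraction (i , t) 0≺x x≺1)) (0≼x i t))
  ... | inj₂ 0≺x = inj₂ (antisym (x≼1 i t) (⊀⇒≽ (no-fraction (i , t) 0≺x)))

  -- From binary entries to a permutation matrix

  One : Fin n → Fin n → Set
  One i t = x i t ≈ 1ℝ

  One⇒0≺ : ∀ {i t} → One i t → 0ℝ ≺ x i t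
  One⇒0≺ e = ≺-≼-trans 0≺1 (≈⇒≽ e)

  One? : ∀ i t → Dec (One i t)
  One? i t with binary i t
  ... | inj₁ x≈0 = no λ x≈1 → ≺⇒⋡ (One⇒0≺ x≈1) (≈⇒≼ x≈0)
  ... | inj₂ x≈1 = yes x≈1

  ¬One⇒≼0 : ∀ {i t} → ¬ One i t → x i t ≼ 0ℝ
  ¬One⇒≼0 {i} {t} x≉1 with binary i t
  ... | inj₁ x≈0 = ≈⇒≼ x≈0
  ... | inj₂ x≈1 = contradiction x≈1 x≉1

  One-∥ : ∀ {i j t u} → (i , t) ∥ (j , u) → One i t → ¬ One j u
  One-∥ a∥b xₐ≈1 x_b≈1 = at-⋡1 a∥b (One⇒0≺ xₐ≈1) (≈⇒≽ x_b≈1)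

  row-unique : ∀ {i t u} → One i t → One i u → t ≡ u
  row-unique {t = t} {u} p q with t ≟ u
  ... | yes t≡u = t≡u
  ... | no  t≢u = contradiction q (One-∥ (row t≢u) p)

  column-unique : ∀ {t i j} → One i t → One j t → i ≡ j
  column-unique {i = i} {j} p q with i ≟ j
  ... | yes i≡j = i≡j
  ... | no  i≢j = contradiction q (One-∥ (column i≢j) p)

  -- Without a one on either line, all their entries vanish, the cell itself included, and
  -- `others-⋠0` is violated.
  covered : ∀ i t → (∃ λ j → One j t) ⊎ (∃ λ u → One i u)
  covered i t with any? (λ j → One? j t) | any? (One? i)
  ... | yes found | _         = inj₁ found
  ... | no  _     | yes found = inj₂ found
  ... | no  none₁ | no  none₂ = contradiction
    (others-≼0 (i , t) zeros)
    (others-⋠0 (i , t) (≼-≺-trans (¬One⇒≼0 (λ p → none₂ (t , p))) 0≺1))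
    where
    zeros : ∀ {b} → (i , t) ∥ b → at x b ≼ 0ℝ
    zeros (column {j = j} _) = ¬One⇒≼0 (λ p → none₁ (j , p))
    zeros (row {u = u} _)    = ¬One⇒≼0 (λ p → none₂ (u , p))

  column-sum : ∀ t → sum (λ i → x i t) ≈ 1ℝ
  column-sum t =
    -- The row statement applied to the transposed pattern, hence `column-unique` and `swap`.
    let i , p = row-nonempty (λ t i → One i t) (λ t i → One? i t) column-unique (λ t i → swap (covered i t)) t
    in antisym
      (≼-trans (sum-≼-term i (λ j i≢j → ¬One⇒≼0 (One-∥ (column i≢j) p))) (≈⇒≼ p))
      (≼-trans (≈⇒≽ p) (term-≼-sum (λ j → 0≼x j t) i))

  row-sum : ∀ i → sum (λ t → x i t) ≈ 1ℝ
  row-sum i =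
    let t , p = row-nonempty One One? row-unique covered i
    in antisym
      (≼-trans (sum-≼-term t (λ u t≢u → ¬One⇒≼0 (One-∥ (row t≢u) p))) (≈⇒≼ p))
      (≼-trans (≈⇒≽ p) (term-≼-sum (0≼x i) t))

theorem3p8 : (n : ℕ) → 3 ℕ.≤ n →
    (c : Matrix n) → (∀ i j → 0ℝ ≤ c i j) →
    (ε : ℝ) → 0ℝ < ε →
    ∃ λ (γ⋆ : ℝ) → 0ℝ < γ⋆ ×
    ((γ : ℝ) → γ⋆ < γ → (x⋆ : Matrix n) → IsLocalMinimizer (f̂time c ε γ) x⋆ →
    IsBinary x⋆ ×
    ((t : Fin n) → (∑[ i < n ] x⋆ i t) ≃ 1ℝ) ×
    ((i : Fin n) → (∑[ t < n ] x⋆ i t) ≃ 1ℝ))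
theorem3p8 n 3≤n c c≥0 ε ε>0 =
  -- The largest possible cost part of a slope plus `ε`, as compared with `γ` in `others-⋠0`.
  cap c + ε
  , ≺⇒< (≺-≼-trans 0≺ε (≼-by (cap-nonNeg 0≼c) (solve 2 (λ z ε → ε :+ z := z :+ ε :+ con 0ℚ) ≈-refl (cap c) ε)))
  , λ γ γ⋆<γ x⋆ minimizer →
      let open LocalMinimizer (ℕₚ.≤-trans (ℕₚ.n≤1+n 2) 3≤n) c 0≼c ε 0≺ε γ (<⇒≺ γ⋆<γ) x⋆ minimizer
      in (λ i t → map ≈⇒≃ ≈⇒≃ (binary i t))
       , (λ t → ≈⇒≃ (column-sum t))
       , (λ i → ≈⇒≃ (row-sum i))
  where
  0≺ε : 0ℝ ≺ ε
  0≺ε = <⇒≺ ε>0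
  0≼c : Nonneg c
  0≼c i j = from-≤ (c≥0 i j)
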